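{- There are absolute constants $K,k$ such that the following holds. Let $\mathcal M$ be any legitimate model of order $n$ of the class of Boolean circuits over $\bigcup_{a\ge 2}\{\neg,\vee_a,\wedge_a\}$ with $\overline\neg=\neg$, let $f\in\mathcal F_n$ and let $d\ge 8$. Then $$\rho_d(f,\mathcal M)\le Knd\left(2^{\lceil n/\lfloor d/8\rfloor\rceil}+1\right)+2^{Kn^{k/d}}+Kn^K .$$
   Context: $\mathcal F_n$ is the set of Boolean functions $\{0,1\}^n\to\{0,1\}$, identified with their sets of ones; $\oplus$ is symmetric difference. The circuit class consists of Boolean circuits with inputs $x_1,\dots,x_n$, constants, and gates labeled by negation or by AND/OR of any arity $a\ge 2$ (denoted $\wedge_a,\vee_a$); depth is the number of edges on the longest path from the output to an input or constant. A legitimate model of order $n$ is a set $\mathcal M$ with $\{0,1,x_1,\dots,x_n\}\subseteq\mathcal M\subseteq\mathcal F_n$ together with, for each connective $\circ$ of arity $a$, a commutative operation $\overline\circ:\mathcal M^a\to\mathcal M$; "$\overline\neg=\neg$" means $\mathcal M$ is closed under complement and $\overline\neg h=\neg h$. For a circuit $C$ the approximating circuit $\overline C\in\mathcal M$ is defined inductively: $\overline0=0,\overline1=1,\overline{x_i}=x_i$, and gate $\circ(C_1,\dots,C_a)$ becomes $\overline\circ(\overline{C_1},\dots,\overline{C_a})$. Error sets: $\delta_\circ(f_1,\dots,f_a):=\circ(f_1,\dots,f_a)\oplus\overline\circ(f_1,\dots,f_a)$ for $f_i\in\mathcal M$. The $d$-depth distance $\rho_d(f,\mathcal M)$ is the minimal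 $t$ such that there exist $g\in\mathcal M$ and $t$ tuples $(\circ_i,f^i_1,\dots,f^i_{a_i})$ ($\circ_i$ a connective of arity $a_i$, $f^i_j\in\mathcal M$) with $f\oplus g\subseteq\bigcup_{i=1}^t\delta_{\circ_i}(f^i_1,\dots,f^i_{a_i})$, where moreover each $f^i_j=\overline C$ for some circuit $C$ of the class of depth at most $d-1$, and $g=\overline D$ for some circuit $D$ of the class of depth at most $d$; if no such $t$ exists, $\rho_d(f,\mathcal M):=\infty$. -}

module Defs where

open import Data.Nat using (ℕ; zero; suc; _+_; _*_; _∸_; _^_; _≤_; _<_; _⊔_; _/_)
open import Data.Bool using (Bool; true; false; not; _∧_; _∨_; _xor_; if_then_else_; T)
open import Data.Fin using (Fin)
import Data.Fin as F
open import Data.Vec using (Vec; []; _∷_; map; lookup; tabulate)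
import Data.Vec as V
open import Data.List using (List; length)
open import Data.List.Relation.Unary.All using (All)
open import Data.List.Relation.Unary.Any using (Any)
open import Data.Product using (Σ; _×_; _,_; proj₁; proj₂)
open import Data.Fin.Permutation using (Permutation′; _⟨$⟩ʳ_)
open import Relation.Binary.PropositionalEquality using (_≡_)

-- Boolean functions {0,1}^n → {0,1}, in canonical (truth-table / Shannon
-- tree) form, so that propositional equality is equality of functions.
-- BF (suc n) = (restriction to x₁ = 0 , restriction to x₁ = 1).

BF : ℕ → Set
BF zero    = Bool
BF (suc n) = BF n × BF n

eval : ∀ {n} → BF n → (Fin n → Bool) → Bool
eval {zero}  b       v = b
eval {suc n} (l , r) v = if v F.zero then eval r (λ i → v (F.suc i))
                                      else eval l (λ i → v (F.suc i))

constBF : ∀ {n} → Bool → BF n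
constBF {zero}  b = b
constBF {suc n} b = constBF b , constBF b

varBF : ∀ {n} → Fin n → BF n
varBF {suc n} F.zero    = constBF false , constBF true
varBF {suc n} (F.suc i) = varBF i , varBF i

pw : ∀ {n a} → (Vec Bool a → Bool) → Vec (BF n) a → BF n
pw {zero}  g fs = g fs
pw {suc n} g fs = pw g (map proj₁ fs) , pw g (map proj₂ fs)

complBF : ∀ {n} → BF n → BF n
complBF f = pw (λ v → not (lookup v F.zero)) (f ∷ [])

_⊕_ : ∀ {n} → BF n → BF n → BF n
f ⊕ g = pw (λ v → lookup v F.zero xor lookup v (F.suc F.zero)) (f ∷ g ∷ [])

data Conn : ℕ → Set where
  ¬c  : Conn 1
  ∧c  : ∀ {a} → 2 ≤ a → Conn a
  ∨c  : ∀ {a} → 2 ≤ a → Conn a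

andV : ∀ {a} → Vec Bool a → Bool
andV = V.foldr _ _∧_ true

orV : ∀ {a} → Vec Bool a → Bool
orV = V.foldr _ _∨_ false

sem : ∀ {n a} → Conn a → Vec (BF n) a → BF n
sem ¬c     fs = pw (λ v → not (lookup v F.zero)) fs
sem (∧c _) fs = pw andV fs
sem (∨c _) fs = pw orV fs

data Circuit (n : ℕ) : Set where
  const : Bool → Circuit n
  var   : Fin n → Circuit n
  gate  : ∀ {a} → Conn a → Vec (Circuit n) a → Circuit n

mutual
  depth : ∀ {n} → Circuit n → ℕ
  depth (const _)   = 0
  depth (var _)     = 0
  depth (gate c Cs) = suc (depthV Cs)

  depthV : ∀ {n a} → Vec (Circuit n) a → ℕ
  depthV []       = 0
  depthV (C ∷ Cs) = depth C ⊔ depthV Cs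

permute : ∀ {A : Set} {a} → Permutation′ a → Vec A a → Vec A a
permute π xs = tabulate (λ i → lookup xs (π ⟨$⟩ʳ i))

record Model (n : ℕ) : Set where
  field
    inM     : BF n → Bool
  Carrier : Set
  Carrier = Σ (BF n) (λ f → T (inM f))
  field
    has-const : ∀ b → T (inM (constBF b))
    has-var   : ∀ i → T (inM (varBF i))
    op        : ∀ {a} → Conn a → Vec Carrier a → Carrier
    op-comm   : ∀ {a} (c : Conn a) (π : Permutation′ a) (fs : Vec Carrier a) →
                op c (permute π fs) ≡ op c fs
    op-neg    : (f : Carrier) → proj₁ (op ¬c (f ∷ [])) ≡ complBF (proj₁ f)

module _ {n : ℕ} (M : Model n) where
  open Model M

  mutual
    approx : Circuit n → Carrier
    approx (const b)   = constBF b , has-const b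
    approx (var i)     = varBF i , has-var i
    approx (gate c Cs) = op c (approxV Cs)

    approxV : ∀ {a} → Vec (Circuit n) a → Vec Carrier a
    approxV []       = []
    approxV (C ∷ Cs) = approx C ∷ approxV Cs

  δ : ∀ {a} → Conn a → Vec Carrier a → BF n
  δ c fs = sem c (map proj₁ fs) ⊕ proj₁ (op c fs)

-- a tuple (∘, C₁,…,C_a); its members f_j are the approximations C_j‾
Tuple : ℕ → Set
Tuple n = Σ ℕ (λ a → Conn a × Vec (Circuit n) a)

ρ≤ : ∀ {n} → Model n → BF n → ℕ → ℕ → Set
ρ≤ {n} M f d t =
  Σ (Circuit n) λ D → depth D ≤ d ×
  Σ (List (Tuple n)) λ ts → length ts ≤ t ×
    All (λ tp → depthV (proj₂ (proj₂ tp)) ≤ d ∸ 1) ts ×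
    (∀ (v : Fin n → Bool) →
       eval (f ⊕ proj₁ (approx M D)) v ≡ true →
       Any (λ tp → eval (δ M (proj₁ (proj₂ tp)) (approxV M (proj₂ (proj₂ tp)))) v ≡ true) ts)

-- ⌈ n / m ⌉ (only used with m ≥ 1)
ceilDiv : ℕ → ℕ → ℕ
ceilDiv n zero    = 0
ceilDiv n (suc m) = (n + m) / suc m

-- LeExp t K n k d  ⟺  t ≤ 2^(K · n^(k/d))  (real exponent), for d ≥ 1.
-- Since t ≤ 2^y ⟺ log₂ t ≤ y, and y^d = K^d · n^k, this holds iff every
-- nonnegative rational p/q < log₂ t (i.e. 2^p < t^q) satisfies
-- (p/q)^d ≤ K^d n^k.
LeExp : ℕ → ℕ → ℕ → ℕ → ℕ → Set
LeExp t K n k d = ∀ (p q : ℕ) → 1 ≤ q → 2 ^ p < t ^ q →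
                  p ^ d ≤ K ^ d * n ^ k * q ^ d

Bound : ℕ → ℕ → ℕ → ℕ → ℕ → Set
Bound K k n d t =
  LeExp (t ∸ (K * n * d * (2 ^ ceilDiv n (d / 8) + 1) + K * n ^ K)) K n k d

-- For a function h let D_h be the circuit that reads the variables in at most ⌊d/8⌋ blocks, branching
-- on each block by a DNF whose leaves are the circuits of the subfunctions of h.  If h is uniformly
-- random, then so are the subfunctions met along the path of an input x; hence the probability that
-- approximating D_h goes wrong at x is at most the sum, over the blocks, of the probabilities that the
-- error sets of the gates of one random block contain x.  Inputs for which this sum is at least 1/64
-- are covered greedily by the error sets of O(nd) blocks, each having at most 2^b + 1 gates (b the block length).  For all
-- other inputs D_h is correct with probability 63/64, so f(x) = h(x) ⊕ (f ⊕ h)(x) is computed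
-- correctly with probability 15/16 from h and f ⊕ h, which are both uniformly random; an AND of ORs
-- of ANDs of independent copies then makes the error smaller than 2^-n with polynomially many gates.
-- As this depth-3 amplification is polynomial, the term 2^(K n^(k/d)) is not needed.

module Submission where

open import Defs
open import Data.Bool using (Bool; true; false; not; _∧_; _∨_; _xor_; if_then_else_)
import Data.Bool as Bool
open import Data.Bool.ListAction using (any)
open import Data.Bool.Properties using (∧-identityʳ; ∨-identityʳ; xor-same)
open import Data.Empty using (⊥-elim)
open import Data.Fin using (Fin; zero; suc; _↑ʳ_)
open import Data.List using (List; []; _∷_; _++_; length; map; concat; filter; replicate; cartesianProduct; cartesianProductWith)
open import Data.List.Membership.Propositional using (_∈_)
open import Data.List.Membership.Propositional.Properties
  using (∈-++⁻; ∈-map⁻; ∈-concat⁻′; ∈-cartesianProductWith⁺; ∈-filter⁺; ∈-filter⁻)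
open import Data.List.Properties using (map-++; length-++; length-filter)
open import Data.List.Relation.Unary.All as All using (All; []; _∷_)
import Data.List.Relation.Unary.All.Properties as All
open import Data.List.Relation.Unary.Any as Any using (Any; here; there)
import Data.List.Relation.Unary.Any.Properties as Any
open import Data.Nat
open import Data.Nat.DivMod using (m≡m%n+[m/n]*n; m%n<n; m/n*n≤m; /-monoˡ-≤)
open import Data.Nat.ListAction using (sum)
open import Data.Nat.ListAction.Properties using (sum-++)
open import Data.Nat.Properties
open import Data.Nat.Tactic.RingSolver using (solve-∀)
open import Data.Product using (Σ; ∃; ∃₂; _×_; _,_; proj₁; proj₂; map₂)
open import Data.Sum using (_⊎_; inj₁; inj₂; [_,_])
open import Data.Unit using (tt)
open import Data.Vec using (Vec; []; _∷_; lookup)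
import Data.Vec as V
import Data.Vec.Properties as V
open import Data.Vec.Relation.Unary.All as VAll using ([]; _∷_) renaming (All to VAll)
import Data.Vec.Relation.Unary.All.Properties as VAll
open import Function using (_∘_; id)
open import Relation.Binary.PropositionalEquality hiding ([_])
open import Relation.Nullary using (Dec; yes; no; ¬_; ¬?)
open import Relation.Nullary.Decidable using (toWitness)
open import Algebra.Properties.CommutativeSemigroup *-commutativeSemigroup using (x∙yz≈y∙xz; x∙yz≈yx∙z)

variable
  A B C : Set
  k m n : ℕ

-- Inequalities between powers of natural numbers

^-distribʳ-* : ∀ k a b → (a * b) ^ k ≡ a ^ k * b ^ k
^-distribʳ-* zero    a b = refl
^-distribʳ-* (suc k) a b rewrite ^-distribʳ-* k a b = lemma a b (a ^ k) (b ^ k)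
  where
  lemma : ∀ a b p q → a * b * (p * q) ≡ a * p * (b * q)
  lemma = solve-∀

n<2^n : ∀ n → n < 2 ^ n
n<2^n zero    = s≤s z≤n
n<2^n (suc n) = ≤-trans (+-mono-≤ (m^n>0 2 n) (n<2^n n)) (≤-reflexive (lemma (2 ^ n)))
  where
  lemma : ∀ p → p + p ≡ 2 * p
  lemma = solve-∀

-- Bernoulli's inequality for `a / z`, multiplied through by `z ^ (k + 1)` to avoid fractions.
bernoulli : ∀ k z a → z ^ k * (z + k * a) ≤ (z + a) ^ k * z
bernoulli zero    z a = ≤-reflexive (lemma z a)
  where
  lemma : ∀ z a → 1 * (z + 0 * a) ≡ 1 * z
  lemma = solve-∀
bernoulli (suc k) z a = begin
  z * z ^ k * (z + (a + k * a))                     ≤⟨ m≤m+n _ (z ^ k * (k * a * a)) ⟩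
  z * z ^ k * (z + (a + k * a)) + z ^ k * (k * a * a) ≡⟨ lemma z a (z ^ k) k ⟩
  (z + a) * (z ^ k * (z + k * a))                   ≤⟨ *-monoʳ-≤ (z + a) (bernoulli k z a) ⟩
  (z + a) * ((z + a) ^ k * z)                       ≡⟨ *-assoc (z + a) ((z + a) ^ k) z ⟨
  (z + a) * (z + a) ^ k * z                         ∎
  where
  open ≤-Reasoning
  lemma : ∀ z a p k → z * p * (z + (a + k * a)) + p * (k * a * a) ≡ (z + a) * (p * (z + k * a))
  lemma = solve-∀

-- Bernoulli gives `(1 + a/z) ^ k ≥ 1 + k * a/z ≥ 2`. With `z` bad and `a` good outcomes, this says
-- that `k` independent draws are all bad with probability at most 1/2; both the greedy halving and
-- the ORs of the amplification rest on it.
2z^k≤[z+a]^k : ∀ k z a → 1 ≤ k → z ≤ k * a → 2 * z ^ k ≤ (z + a) ^ k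
-- The general case cancels a factor `z`, so `z = 0` is separate; here `k ≥ 1` makes the left side
-- 0.
2z^k≤[z+a]^k (suc k) zero      a _ _ = z≤n
2z^k≤[z+a]^k k       z@(suc _) a _ z≤ka = *-cancelʳ-≤ _ _ z (begin
  2 * z ^ k * z       ≡⟨ lemma z (z ^ k) ⟩
  z ^ k * (z + z)     ≤⟨ *-monoʳ-≤ (z ^ k) (+-monoʳ-≤ z z≤ka) ⟩
  z ^ k * (z + k * a) ≤⟨ bernoulli k z a ⟩
  (z + a) ^ k * z     ∎)
  where
  open ≤-Reasoning
  lemma : ∀ z p → 2 * p * z ≡ p * (z + z)
  lemma = solve-∀

-- This is `1 - (1 - p) ^ s ≤ s * p` for `p = a / (z + a)`, with denominators cleared.
union-bound : ∀ s z a → (z + a) * (z + a) ^ s ≤ (z + a) * z ^ s + s * a * (z + a) ^ s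
union-bound zero    z a = m≤m+n _ _
union-bound (suc s) z a = begin
  N * (N * N ^ s)                             ≤⟨ *-monoʳ-≤ N (union-bound s z a) ⟩
  N * (N * z ^ s + s * a * N ^ s)             ≡⟨ lemma₁ z a s (z ^ s) (N ^ s) ⟩
  N * (z * z ^ s) + a * (N * z ^ s) + s * a * (N * N ^ s)
    ≤⟨ +-monoˡ-≤ _ (+-monoʳ-≤ (N * (z * z ^ s)) (*-monoʳ-≤ a (*-monoʳ-≤ N (^-monoˡ-≤ s (m≤m+n z a))))) ⟩
  N * (z * z ^ s) + a * (N * N ^ s) + s * a * (N * N ^ s) ≡⟨ lemma₂ z a s (z ^ s) (N ^ s) ⟩
  N * (z * z ^ s) + (a + s * a) * (N * N ^ s) ∎
  where
  open ≤-Reasoning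
  N = z + a
  lemma₁ : ∀ z a s p q → (z + a) * ((z + a) * p + s * a * q)
         ≡ (z + a) * (z * p) + a * ((z + a) * p) + s * a * ((z + a) * q)
  lemma₁ = solve-∀
  lemma₂ : ∀ z a s p q → (z + a) * (z * p) + a * ((z + a) * q) + s * a * ((z + a) * q)
         ≡ (z + a) * (z * p) + (a + s * a) * ((z + a) * q)
  lemma₂ = solve-∀

-- Sums over lists and counting

⟦_⟧ : Bool → ℕ
⟦ b ⟧ = if b then 1 else 0

∑ : List A → (A → ℕ) → ℕ
∑ xs F = sum (map F xs)

∑-cong : ∀ (xs : List A) {F G} → (∀ a → F a ≡ G a) → ∑ xs F ≡ ∑ xs G
∑-cong []       F≗G = refl
∑-cong (x ∷ xs) F≗G = cong₂ _+_ (F≗G x) (∑-cong xs F≗G)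

∑-mono : ∀ (xs : List A) {F G} → (∀ a → F a ≤ G a) → ∑ xs F ≤ ∑ xs G
∑-mono []       F≤G = z≤n
∑-mono (x ∷ xs) F≤G = +-mono-≤ (F≤G x) (∑-mono xs F≤G)

∑-const : ∀ (xs : List A) c → ∑ xs (λ _ → c) ≡ length xs * c
∑-const []       c = refl
∑-const (x ∷ xs) c = cong (c +_) (∑-const xs c)

∑-+ : ∀ (xs : List A) F G → ∑ xs (λ a → F a + G a) ≡ ∑ xs F + ∑ xs G
∑-+ []       F G = refl
∑-+ (x ∷ xs) F G rewrite ∑-+ xs F G = lemma (F x) (G x) (∑ xs F) (∑ xs G)
  where
  lemma : ∀ a b c d → a + b + (c + d) ≡ a + c + (b + d)
  lemma = solve-∀

∑-*ˡ : ∀ (xs : List A) c F → ∑ xs (λ a → c * F a) ≡ c * ∑ xs F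
∑-*ˡ []       c F = sym (*-zeroʳ c)
∑-*ˡ (x ∷ xs) c F rewrite ∑-*ˡ xs c F = sym (*-distribˡ-+ c (F x) (∑ xs F))

∑-*ʳ : ∀ (xs : List A) c F → ∑ xs (λ a → F a * c) ≡ ∑ xs F * c
∑-*ʳ xs c F = trans (∑-cong xs λ a → *-comm (F a) c) (trans (∑-*ˡ xs c F) (*-comm c (∑ xs F)))

∑-++ : ∀ (xs ys : List A) F → ∑ (xs ++ ys) F ≡ ∑ xs F + ∑ ys F
∑-++ xs ys F rewrite map-++ F xs ys = sum-++ (map F xs) (map F ys)

∑-map : ∀ (f : A → B) xs F → ∑ (map f xs) F ≡ ∑ xs (F ∘ f)
∑-map f []       F = refl
∑-map f (x ∷ xs) F = cong (F (f x) +_) (∑-map f xs F)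

∑-swap : ∀ (xs : List A) (ys : List B) (F : A → B → ℕ) → ∑ xs (λ a → ∑ ys (F a)) ≡ ∑ ys (λ b → ∑ xs (λ a → F a b))
∑-swap []       ys F = sym (trans (∑-const ys 0) (*-zeroʳ (length ys)))
∑-swap (x ∷ xs) ys F rewrite ∑-swap xs ys F = sym (∑-+ ys (F x) (λ b → ∑ xs (λ a → F a b)))

∑-product : ∀ (f : A → B → C) xs ys F →
            ∑ (cartesianProductWith f xs ys) F ≡ ∑ xs (λ a → ∑ ys (λ b → F (f a b)))
∑-product f []       ys F = refl
∑-product f (x ∷ xs) ys F = trans (∑-++ (map (f x) ys) _ F)
  (cong₂ _+_ (∑-map (f x) ys F) (∑-product f xs ys F))

length≡∑1 : ∀ (xs : List A) → length xs ≡ ∑ xs (λ _ → 1)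
length≡∑1 xs = sym (trans (∑-const xs 1) (*-identityʳ _))

∑-not : ∀ (xs : List A) p → ∑ xs (⟦_⟧ ∘ not ∘ p) + ∑ xs (⟦_⟧ ∘ p) ≡ length xs
∑-not xs p = trans (sym (∑-+ xs _ _)) (trans (∑-cong xs (λ a → lemma (p a))) (sym (length≡∑1 xs)))
  where
  lemma : ∀ b → ⟦ not b ⟧ + ⟦ b ⟧ ≡ 1
  lemma true  = refl
  lemma false = refl

averaging : ∀ (xs : List A) F k → 0 < length xs → length xs * k ≤ ∑ xs F →
            ∃ λ a → a ∈ xs × k ≤ F a
averaging (x ∷ xs) F k _ le with k ≤? F x
... | yes k≤Fx = x , here refl , k≤Fx
averaging (x ∷ [])     F k _ le | no k≰Fx = ⊥-elim (k≰Fx (+-cancelʳ-≤ 0 k (F x) le))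
averaging (x ∷ y ∷ ys) F k _ le | no k≰Fx = map₂ (λ (a∈ , ka) → there a∈ , ka)
  (averaging (y ∷ ys) F k (s≤s z≤n)
    (+-cancelˡ-≤ k _ _ (≤-trans le (+-monoˡ-≤ _ (≰⇒≥ k≰Fx)))))

averaging-zero : ∀ (xs : List A) F → ∑ xs F < length xs → ∃ λ a → F a ≡ 0
averaging-zero (x ∷ xs) F lt with F x in eq
... | zero  = x , eq
... | suc k = averaging-zero xs F (≤-trans (s≤s (m≤n+m (∑ xs F) k)) (s≤s⁻¹ lt))

∑≡0⇒≡0 : ∀ {xs : List A} {F a} → ∑ xs F ≡ 0 → a ∈ xs → F a ≡ 0
∑≡0⇒≡0 {F = F} eq (here {x} refl) = m+n≡0⇒m≡0 (F x) eq
∑≡0⇒≡0 {F = F} eq (there {x} a∈)  = ∑≡0⇒≡0 (m+n≡0⇒n≡0 (F x) eq) a∈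

-- A union bound over at most `c` events of probability below `1 / c`. The hypothesis `0 < M` makes
-- the strict inequality hold for the empty list.
∑-scaled-< : ∀ (xs : List A) F c M → 0 < M → length xs ≤ c → (∀ {a} → a ∈ xs → c * F a < M) →
             ∑ xs F < M
∑-scaled-< []       F c M 0<M _ _ = 0<M
∑-scaled-< (x ∷ xs) F c M _ |xs|≤c small = *-cancelˡ-< c _ M (begin-strict
  c * ∑ (x ∷ xs) F        <⟨ go x xs small ⟩
  length (x ∷ xs) * M     ≤⟨ *-monoˡ-≤ M |xs|≤c ⟩
  c * M                   ∎)
  where
  open ≤-Reasoning
  go : ∀ y ys → (∀ {a} → a ∈ y ∷ ys → c * F a < M) → c * ∑ (y ∷ ys) F < length (y ∷ ys) * M
  go y []       sm = subst₂ (λ p q → c * p < q) (sym (+-identityʳ (F y))) (sym (+-identityʳ M)) (sm (here refl))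
  go y (z ∷ ys) sm = subst (_< M + length (z ∷ ys) * M) (sym (*-distribˡ-+ c (F y) (∑ (z ∷ ys) F)))
    (+-mono-< (sm (here refl)) (go z ys (sm ∘ there)))

vectors : List A → ∀ k → List (Vec A k)
vectors xs zero    = [] ∷ []
vectors xs (suc k) = cartesianProductWith _∷_ xs (vectors xs k)

length-vectors : ∀ (xs : List A) k → length (vectors xs k) ≡ length xs ^ k
length-vectors xs zero    = refl
length-vectors xs (suc k) = begin
  length (vectors xs (suc k))              ≡⟨ length≡∑1 (vectors xs (suc k)) ⟩
  ∑ (vectors xs (suc k)) (λ _ → 1)         ≡⟨ ∑-product _∷_ xs (vectors xs k) _ ⟩
  ∑ xs (λ _ → ∑ (vectors xs k) (λ _ → 1))  ≡⟨ ∑-const xs _ ⟩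
  length xs * ∑ (vectors xs k) (λ _ → 1)   ≡⟨ cong (length xs *_) (length≡∑1 (vectors xs k)) ⟨
  length xs * length (vectors xs k)        ≡⟨ cong (length xs *_) (length-vectors xs k) ⟩
  length xs * length xs ^ k                ∎
  where open ≡-Reasoning

-- Independence in counting form: `vectors xs k` lists the outcomes of `k` independent draws from
-- `xs`, so the count factorises.
∑-andV : ∀ (xs : List A) p k → ∑ (vectors xs k) (λ v → ⟦ andV (V.map p v) ⟧) ≡ ∑ xs (⟦_⟧ ∘ p) ^ k
∑-andV xs p zero    = refl
∑-andV xs p (suc k) = begin
  ∑ (vectors xs (suc k)) (λ v → ⟦ andV (V.map p v) ⟧)
    ≡⟨ ∑-product _∷_ xs (vectors xs k) _ ⟩
  ∑ xs (λ a → ∑ (vectors xs k) (λ v → ⟦ p a ∧ andV (V.map p v) ⟧))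
    ≡⟨ ∑-cong xs (λ a → trans (∑-cong (vectors xs k) (λ v → ⟦∧⟧ (p a) _)) (∑-*ˡ (vectors xs k) ⟦ p a ⟧ _)) ⟩
  ∑ xs (λ a → ⟦ p a ⟧ * ∑ (vectors xs k) (λ v → ⟦ andV (V.map p v) ⟧))
    ≡⟨ ∑-*ʳ xs _ (⟦_⟧ ∘ p) ⟩
  ∑ xs (⟦_⟧ ∘ p) * ∑ (vectors xs k) (λ v → ⟦ andV (V.map p v) ⟧)
    ≡⟨ cong (∑ xs (⟦_⟧ ∘ p) *_) (∑-andV xs p k) ⟩
  ∑ xs (⟦_⟧ ∘ p) * ∑ xs (⟦_⟧ ∘ p) ^ k ∎
  where
  open ≡-Reasoning
  ⟦∧⟧ : ∀ a b → ⟦ a ∧ b ⟧ ≡ ⟦ a ⟧ * ⟦ b ⟧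
  ⟦∧⟧ true  b = sym (+-identityʳ ⟦ b ⟧)
  ⟦∧⟧ false b = refl

∑-not-orV : ∀ (xs : List A) p k →
            ∑ (vectors xs k) (λ v → ⟦ not (orV (V.map p v)) ⟧) ≡ ∑ xs (⟦_⟧ ∘ not ∘ p) ^ k
∑-not-orV xs p k = trans (∑-cong (vectors xs k) (cong ⟦_⟧ ∘ deMorgan)) (∑-andV xs (not ∘ p) k)
  where
  deMorgan : ∀ {k} (v : Vec _ k) → not (orV (V.map p v)) ≡ andV (V.map (not ∘ p) v)
  deMorgan []      = refl
  deMorgan (a ∷ v) with p a
  ... | true  = refl
  ... | false = deMorgan v

-- Greedy covering

module Greedy {Test Point : Set} (tests : List Test) (hit : Test → Point → Bool)
              (a : ℕ) (nonempty : 0 < length tests) where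

  private
    ∣tests∣ = length tests

  -- A uniformly drawn test hits `x` with probability at least `1 / (a + 1)`. Repetitions in `tests`
  -- count, so multiplicities act as weights.
  Rich : Point → Set
  Rich x = ∣tests∣ ≤ suc a * ∑ tests (λ t → ⟦ hit t x ⟧)

  Covers : List Test → Point → Set
  Covers ts x = Any (λ t → hit t x ≡ true) ts

  missed : Test → List Point → List Point
  missed t = filter (λ x → hit t x Bool.≟ false)

  missed-length : ∀ t U → length (missed t U) + ∑ U (⟦_⟧ ∘ hit t) ≡ length U
  missed-length t []      = refl
  missed-length t (x ∷ U) with hit t x
  ... | false = cong suc (missed-length t U)
  ... | true  = trans (+-suc _ _) (cong suc (missed-length t U))

  -- Double counting: on average over the tests, a `1 / (a + 1)` fraction of `U` is hit, because
  -- this holds for each point on average over the tests. Some test does at least as well as the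
  -- average.
  step : ∀ U → (∀ {x} → x ∈ U → Rich x) →
         ∃ λ t → t ∈ tests × suc a * length (missed t U) ≤ a * length U
  step U rich with averaging tests (λ t → suc a * ∑ U (⟦_⟧ ∘ hit t)) (length U) nonempty enough
    where
    open ≤-Reasoning
    sum-rich : ∀ V → (∀ {x} → x ∈ V → Rich x) →
               length V * ∣tests∣ ≤ ∑ V (λ x → suc a * ∑ tests (λ t → ⟦ hit t x ⟧))
    sum-rich []      _ = z≤n
    sum-rich (x ∷ V) r = +-mono-≤ (r (here refl)) (sum-rich V (r ∘ there))
    enough : ∣tests∣ * length U ≤ ∑ tests (λ t → suc a * ∑ U (⟦_⟧ ∘ hit t))
    enough = begin
      ∣tests∣ * length U                                 ≡⟨ *-comm ∣tests∣ (length U) ⟩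
      length U * ∣tests∣                                 ≤⟨ sum-rich U rich ⟩
      ∑ U (λ x → suc a * ∑ tests (λ t → ⟦ hit t x ⟧))    ≡⟨ ∑-*ˡ U (suc a) _ ⟩
      suc a * ∑ U (λ x → ∑ tests (λ t → ⟦ hit t x ⟧))    ≡⟨ cong (suc a *_) (∑-swap U tests _) ⟩
      suc a * ∑ tests (λ t → ∑ U (⟦_⟧ ∘ hit t))          ≡⟨ ∑-*ˡ tests (suc a) _ ⟨
      ∑ tests (λ t → suc a * ∑ U (⟦_⟧ ∘ hit t))          ∎
  ... | t , t∈ , le = t , t∈ , +-cancelʳ-≤ (length U) _ _ (begin
      suc a * u + length U        ≤⟨ +-monoʳ-≤ _ le ⟩
      suc a * u + suc a * s       ≡⟨ *-distribˡ-+ (suc a) u s ⟨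
      suc a * (u + s)             ≡⟨ cong (suc a *_) (missed-length t U) ⟩
      length U + a * length U     ≡⟨ +-comm (length U) _ ⟩
      a * length U + length U     ∎)
    where
    open ≤-Reasoning
    u = length (missed t U)
    s = ∑ U (⟦_⟧ ∘ hit t)

  record Reduction (U : List Point) (m : ℕ) : Set where
    field
      chosen    : List Test
      size      : length chosen ≡ m
      valid     : All (_∈ tests) chosen
      remaining : List Point
      subset    : ∀ {x} → x ∈ remaining → x ∈ U
      covered   : ∀ {x} → x ∈ U → Covers chosen x ⊎ x ∈ remaining
  open Reduction

  steps : ∀ m U → (∀ {x} → x ∈ U → Rich x) →
          Σ (Reduction U m) λ R → suc a ^ m * length (remaining R) ≤ a ^ m * length U
  steps zero    U rich = record
    { chosen = [] ; size = refl ; valid = [] ; remaining = U ; subset = id ; covered = inj₂ } , ≤-refl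
  steps (suc m) U rich = record
    { chosen    = t ∷ chosen R
    ; size      = cong suc (size R)
    ; valid     = proj₁ (proj₂ first) ∷ valid R
    ; remaining = remaining R
    ; subset    = proj₁ ∘ ∈-filter⁻ hits? ∘ subset R
    ; covered   = λ {x} → extend x
    } , (begin
      suc a * suc a ^ m * length (remaining R)   ≡⟨ *-assoc (suc a) (suc a ^ m) _ ⟩
      suc a * (suc a ^ m * length (remaining R)) ≤⟨ *-monoʳ-≤ (suc a) (proj₂ rest) ⟩
      suc a * (a ^ m * length (missed t U))      ≡⟨ x∙yz≈y∙xz (suc a) (a ^ m) _ ⟩
      a ^ m * (suc a * length (missed t U))      ≤⟨ *-monoʳ-≤ (a ^ m) (proj₂ (proj₂ first)) ⟩
      a ^ m * (a * length U)                     ≡⟨ x∙yz≈yx∙z (a ^ m) a _ ⟩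
      a * a ^ m * length U                       ∎)
    where
    open ≤-Reasoning
    first = step U rich
    t = proj₁ first
    hits? = λ x → hit t x Bool.≟ false
    rest = steps m (missed t U) (rich ∘ proj₁ ∘ ∈-filter⁻ hits?)
    R = proj₁ rest
    extend : ∀ x → x ∈ U → Covers (t ∷ chosen R) x ⊎ x ∈ remaining R
    extend x x∈U with hit t x in eq
    ... | true  = inj₁ (here eq)
    ... | false = [ inj₁ ∘ there , inj₂ ] (covered R (∈-filter⁺ hits? x∈U eq))

  -- Each step keeps at most an `a / (a + 1)` fraction, and `(a / (a + 1)) ^ (a + 1) ≤ 1/2`.
  halve : ∀ U → (∀ {x} → x ∈ U → Rich x) →
          Σ (Reduction U (suc a)) λ R → 2 * length (remaining R) ≤ length U
  halve U rich = R , *-cancelˡ-≤ p {{m^n≢0 (suc a) (suc a)}} (begin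
      p * (2 * r)                    ≡⟨ x∙yz≈y∙xz p 2 r ⟩
      2 * (p * r)                    ≤⟨ *-monoʳ-≤ 2 (proj₂ reduced) ⟩
      2 * (a ^ suc a * length U)     ≡⟨ *-assoc 2 (a ^ suc a) (length U) ⟨
      2 * a ^ suc a * length U       ≤⟨ *-monoˡ-≤ (length U) (2z^k≤[z+a]^k (suc a) a 1 (s≤s z≤n)
                                          (≤-trans (n≤1+n a) (≤-reflexive (sym (*-identityʳ (suc a)))))) ⟩
      (a + 1) ^ suc a * length U     ≡⟨ cong (λ b → b ^ suc a * length U) (+-comm a 1) ⟩
      p * length U                   ∎)
    where
    open ≤-Reasoning
    reduced = steps (suc a) U rich
    R = proj₁ reduced
    p = suc a ^ suc a
    r = length (remaining R)

  -- After `k` halvings fewer than `2 ^ 0` points remain, hence none; the strict bound on `length U`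
  -- is what forces this.
  cover : ∀ k U → length U < 2 ^ k → (∀ {x} → x ∈ U → Rich x) →
          ∃ λ ts → length ts ≡ k * suc a × All (_∈ tests) ts × (∀ {x} → x ∈ U → Covers ts x)
  cover zero    []      _ _ = [] , refl , [] , λ ()
  cover zero    (_ ∷ _) (s≤s ()) _
  cover (suc k) U lt rich =
      chosen R ++ proj₁ rest
    , trans (length-++ (chosen R)) (cong₂ _+_ (size R) (proj₁ (proj₂ rest)))
    , All.++⁺ (valid R) (proj₁ (proj₂ (proj₂ rest)))
    , λ x∈U → [ Any.++⁺ˡ , Any.++⁺ʳ (chosen R) ∘ proj₂ (proj₂ (proj₂ rest)) ] (covered R x∈U)
    where
    halved = halve U rich
    R = proj₁ halved
    rest = cover k (remaining R) (*-cancelˡ-< 2 _ _ (≤-<-trans (proj₂ halved) lt)) (rich ∘ subset R)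

-- Boolean functions and approximating circuits

eval-pw : ∀ {n a} (g : Vec Bool a → Bool) (fs : Vec (BF n) a) v →
          eval (pw g fs) v ≡ g (V.map (λ f → eval f v) fs)
eval-pw {zero}  g fs v = cong g (sym (V.map-id fs))
eval-pw {suc n} g fs v with v zero
... | true  = trans (eval-pw g (V.map proj₂ fs) _) (cong g (sym (V.map-∘ _ proj₂ fs)))
... | false = trans (eval-pw g (V.map proj₁ fs) _) (cong g (sym (V.map-∘ _ proj₁ fs)))

eval-⊕ : (f g : BF n) → ∀ v → eval (f ⊕ g) v ≡ eval f v xor eval g v
eval-⊕ f g v = eval-pw _ (f ∷ g ∷ []) v

eval-const : ∀ n b v → eval (constBF {n} b) v ≡ b
eval-const zero    b v = refl
eval-const (suc n) b v with v zero
... | true  = eval-const n b _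
... | false = eval-const n b _

eval-var : ∀ {n} (i : Fin n) v → eval (varBF i) v ≡ v i
eval-var {suc n} zero v with v zero
... | true  = eval-const n true _
... | false = eval-const n false _
eval-var {suc n} (suc i) v with v zero
... | true  = eval-var i _
... | false = eval-var i _

eval-cong : ∀ {n} (f : BF n) {v w} → v ≗ w → eval f v ≡ eval f w
eval-cong {zero}  f v≗w = refl
eval-cong {suc n} f {v} {w} v≗w rewrite v≗w zero with w zero
... | true  = eval-cong (proj₂ f) (v≗w ∘ suc)
... | false = eval-cong (proj₁ f) (v≗w ∘ suc)

fold : Bool → Vec Bool k → Bool
fold true  = andV
fold false = orV

conn : Bool → 2 ≤ k → Conn k
conn true  = ∧c
conn false = ∨c

-- Connectives have arity at least 2, so an empty junction becomes the neutral element and a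
-- singleton its only argument; neither produces an error set.
junction : Bool → Vec (Circuit n) k → Circuit n
junction b []            = const b
junction b (C ∷ [])      = C
junction b (C ∷ C′ ∷ Cs) = gate (conn b (s≤s (s≤s z≤n))) (C ∷ C′ ∷ Cs)

junction-tests : Bool → Vec (Circuit n) k → List (Tuple n)
junction-tests b []            = []
junction-tests b (C ∷ [])      = []
junction-tests b (C ∷ C′ ∷ Cs) = (_ , conn b (s≤s (s≤s z≤n)) , C ∷ C′ ∷ Cs) ∷ []

-- A circuit together with the tuples whose errors are charged to it.
Tested : ℕ → Set
Tested n = Circuit n × List (Tuple n)

untested : Circuit n → Tested n
untested C = C , []

gather : (A → Tested n) → Vec A k → List (Tuple n)
gather t []      = []
gather t (a ∷ v) = proj₂ (t a) ++ gather t v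

join : Bool → (A → Tested n) → Vec A k → Tested n
join b t v = junction b (V.map (proj₁ ∘ t) v) , junction-tests b (V.map (proj₁ ∘ t) v) ++ gather t v

arg-depth : Tuple n → ℕ
arg-depth tp = depthV (proj₂ (proj₂ tp))

depthV≤ : ∀ {d} {Cs : Vec (Circuit n) k} → VAll (λ C → depth C ≤ d) Cs → depthV Cs ≤ d
depthV≤ []       = z≤n
depthV≤ (p ∷ ps) = ⊔-lub p (depthV≤ ps)

junction-depth : ∀ {d} b {Cs : Vec (Circuit n) k} → VAll (λ C → depth C ≤ d) Cs →
                 depth (junction b Cs) ≤ suc d
junction-depth b []            = z≤n
junction-depth b (p ∷ [])      = m≤n⇒m≤1+n p
junction-depth b (p ∷ p′ ∷ ps) = s≤s (depthV≤ (p ∷ p′ ∷ ps))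

junction-tests-depth : ∀ {d} b {Cs : Vec (Circuit n) k} → VAll (λ C → depth C ≤ d) Cs →
                       All (λ tp → arg-depth tp < suc d) (junction-tests b Cs)
junction-tests-depth b []            = []
junction-tests-depth b (p ∷ [])      = []
junction-tests-depth b (p ∷ p′ ∷ ps) = s≤s (depthV≤ (p ∷ p′ ∷ ps)) ∷ []

junction-tests-length : ∀ b (Cs : Vec (Circuit n) k) → length (junction-tests b Cs) ≤ 1
junction-tests-length b []            = z≤n
junction-tests-length b (C ∷ [])      = z≤n
junction-tests-length b (C ∷ C′ ∷ Cs) = s≤s z≤n

module Evaluation {n : ℕ} (M : Model n) where

  -- Vectors rather than functions, so that all points can be listed; `eval-cong` later carries the
  -- result over to arbitrary assignments.
  Point : Set
  Point = Vec Bool n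

  val : Circuit n → Point → Bool
  val C x = eval (proj₁ (approx M C)) (lookup x)

  err : Point → Tuple n → Bool
  err x tp = eval (δ M (proj₁ (proj₂ tp)) (approxV M (proj₂ (proj₂ tp)))) (lookup x)

  Clean : Point → List (Tuple n) → Set
  Clean x = All (λ tp → err x tp ≡ false)

  eval-approxV : ∀ (Cs : Vec (Circuit n) k) x →
    V.map (λ f → eval f (lookup x)) (V.map proj₁ (approxV M Cs)) ≡ V.map (λ C → val C x) Cs
  eval-approxV []       x = refl
  eval-approxV (C ∷ Cs) x = cong (val C x ∷_) (eval-approxV Cs x)

  val-gate : ∀ b (p : 2 ≤ k) Cs x → err x (_ , conn b p , Cs) ≡ false →
             val (gate (conn b p) Cs) x ≡ fold b (V.map (λ C → val C x) Cs)
  val-gate b p Cs x clean = trans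
    (sym (xor-false (trans (sym (eval-⊕ (sem (conn b p) (V.map proj₁ (approxV M Cs))) _ (lookup x))) clean)))
    (trans (eval-sem b) (cong (fold b) (eval-approxV Cs x)))
    where
    xor-false : ∀ {a b} → a xor b ≡ false → a ≡ b
    xor-false {true}  {true}  _ = refl
    xor-false {false} {false} _ = refl
    eval-sem : ∀ b {fs} → eval (sem (conn b p) fs) (lookup x) ≡ fold b (V.map (λ f → eval f (lookup x)) fs)
    eval-sem true  {fs} = eval-pw _ fs (lookup x)
    eval-sem false {fs} = eval-pw _ fs (lookup x)

  val-junction : ∀ b (Cs : Vec (Circuit n) k) x → Clean x (junction-tests b Cs) →
                 val (junction b Cs) x ≡ fold b (V.map (λ C → val C x) Cs)
  val-junction true  []            x _ = eval-const n true (lookup x)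
  val-junction false []            x _ = eval-const n false (lookup x)
  val-junction true  (C ∷ [])      x _ = sym (∧-identityʳ _)
  val-junction false (C ∷ [])      x _ = sym (∨-identityʳ _)
  val-junction b (C ∷ C′ ∷ Cs) x (p ∷ []) = val-gate b (s≤s (s≤s z≤n)) (C ∷ C′ ∷ Cs) x p

  val-var : ∀ i x → val (var i) x ≡ lookup x i
  val-var i x = eval-var i (lookup x)

  -- Negation is exact in the model, so negative literals are never charged with an error.
  val-¬var : ∀ i x → val (gate ¬c (var i ∷ [])) x ≡ not (lookup x i)
  val-¬var i x = trans (cong (λ f → eval f (lookup x)) (Model.op-neg M (approx M (var i))))
    (trans (eval-pw _ (varBF i ∷ []) (lookup x)) (cong not (eval-var i (lookup x))))

  -- Correctness is required only outside the error sets charged to `t`, and `s` counts these tuples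
  -- rather than gates. The strict inequality in `depths<` is the condition of depth at most `d - 1`
  -- on the arguments of a tuple.
  record Computes (d s : ℕ) (t : Tested n) (g : Point → Bool) : Set where
    field
      depth≤  : depth (proj₁ t) ≤ d
      size≤   : length (proj₂ t) ≤ s
      depths< : All (λ tp → arg-depth tp < d) (proj₂ t)
      correct : ∀ x → Clean x (proj₂ t) → val (proj₁ t) x ≡ g x
  open Computes public

  Computes-cong : ∀ {d s t g h} → g ≗ h → Computes d s t g → Computes d s t h
  Computes-cong g≗h c = record
    { depth≤ = depth≤ c ; size≤ = size≤ c ; depths< = depths< c
    ; correct = λ x cl → trans (correct c x cl) (g≗h x) }

  -- The approximated value is its own specification. Errors inside `C` are thus left out here,
  -- which lets each block answer for its own gates only.
  Computes-untested : ∀ {d} C → depth C ≤ d → Computes d 0 (untested C) (val C)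
  Computes-untested C d≤ = record
    { depth≤ = d≤ ; size≤ = z≤n ; depths< = [] ; correct = λ _ _ → refl }

  Computes-join : ∀ {d s} b (t : A → Tested n) (g : A → Point → Bool) (v : Vec A k) →
    VAll (λ a → Computes d s (t a) (g a)) v →
    Computes (suc d) (suc (k * s)) (join b t v) (λ x → fold b (V.map (λ a → g a x) v))
  Computes-join {d = d} {s} b t g v cs = record
    { depth≤  = junction-depth b depths
    ; size≤   = ≤-trans (≤-reflexive (length-++ (junction-tests b (V.map (proj₁ ∘ t) v))))
                        (+-mono-≤ (junction-tests-length b (V.map (proj₁ ∘ t) v)) (gather-length cs))
    ; depths< = All.++⁺ (junction-tests-depth b depths) (gather-depths cs)
    ; correct = λ x cl → trans
        (val-junction b (V.map (proj₁ ∘ t) v) x (All.++⁻ˡ _ cl))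
        (cong (fold b) (gather-correct cs x (All.++⁻ʳ (junction-tests b (V.map (proj₁ ∘ t) v)) cl)))
    }
    where
    depths : VAll (λ C → depth C ≤ d) (V.map (proj₁ ∘ t) v)
    depths = VAll.map⁺ (VAll.map depth≤ cs)
    gather-length : ∀ {k} {v : Vec _ k} → VAll (λ a → Computes d s (t a) (g a)) v →
                    length (gather t v) ≤ k * s
    gather-length []                 = z≤n
    gather-length (_∷_ {x = a} c cs) = ≤-trans (≤-reflexive (length-++ (proj₂ (t a))))
                                               (+-mono-≤ (size≤ c) (gather-length cs))
    gather-depths : ∀ {k} {v : Vec _ k} → VAll (λ a → Computes d s (t a) (g a)) v →
                    All (λ tp → arg-depth tp < suc d) (gather t v)
    gather-depths []       = []
    gather-depths (c ∷ cs) = All.++⁺ (All.map m≤n⇒m≤1+n (depths< c)) (gather-depths cs)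
    gather-correct : ∀ {k} {v : Vec _ k} → VAll (λ a → Computes d s (t a) (g a)) v →
                     ∀ x → Clean x (gather t v) →
                     V.map (λ C → val C x) (V.map (proj₁ ∘ t) v) ≡ V.map (λ a → g a x) v
    gather-correct []                 x _  = refl
    gather-correct (_∷_ {x = a} c cs) x cl = cong₂ _∷_ (correct c x (All.++⁻ˡ _ cl))
                                                      (gather-correct cs x (All.++⁻ʳ (proj₂ (t a)) cl))

-- Branching on a block of variables

restrict : ∀ c → BF (c + m) → (Fin (c + m) → Bool) → BF m
restrict zero    h       v = h
restrict (suc c) (l , r) v = if v zero then restrict c r (v ∘ suc) else restrict c l (v ∘ suc)

eval-restrict : ∀ c (h : BF (c + m)) v → eval (restrict c h v) (v ∘ (c ↑ʳ_)) ≡ eval h v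
eval-restrict zero    h       v = refl
eval-restrict (suc c) (l , r) v with v zero
... | true  = eval-restrict c r (v ∘ suc)
... | false = eval-restrict c l (v ∘ suc)

-- One term per assignment to the first `c` variables: the `c` literals that select it, and the
-- circuit of the subfunction it leads to. The map `ι` tells which input of the circuit each
-- variable of `h` stands for.
terms : ∀ c → (Fin (c + m) → Fin n) → (BF m → Circuit n) → BF (c + m) →
        Vec (Vec (Circuit n) (c + 1)) (2 ^ c)
terms zero    ι g h       = (g h ∷ []) ∷ []
terms (suc c) ι g (l , r) =
  V.map (gate ¬c (var (ι zero) ∷ []) ∷_) (terms c (ι ∘ suc) g l) V.++
  -- The trailing `[]` matches `2 ^ suc c`, which unfolds to `2 ^ c + (2 ^ c + 0)`.
  (V.map (var (ι zero) ∷_) (terms c (ι ∘ suc) g r) V.++ [])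

terms-depth : ∀ c {d} (ι : Fin (c + m) → Fin n) (g : BF m → Circuit n) h → (∀ h → depth (g h) ≤ suc d) →
              VAll (VAll (λ C → depth C ≤ suc d)) (terms c ι g h)
terms-depth zero    ι g h       g≤ = (g≤ h ∷ []) ∷ []
terms-depth (suc c) ι g (l , r) g≤ = VAll.++⁺
  (VAll.map⁺ (VAll.map (s≤s z≤n ∷_) (terms-depth c (ι ∘ suc) g l g≤)))
  (VAll.++⁺ (VAll.map⁺ (VAll.map (z≤n ∷_) (terms-depth c (ι ∘ suc) g r g≤))) [])

block : ∀ c → (Fin (c + m) → Fin n) → (BF m → Circuit n) → BF (c + m) → Tested n
block c ι g h = join false (join true untested) (terms c ι g h)

module Block {n : ℕ} (M : Model n) where
  open Evaluation M

  dnf : Vec (Vec (Circuit n) m) k → Point → Bool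
  dnf ts x = orV (V.map (λ t → andV (V.map (λ C → val C x) t)) ts)

  dnf-++ : ∀ {a b} (ts : Vec (Vec (Circuit n) m) a) (us : Vec (Vec (Circuit n) m) b) x →
           dnf (ts V.++ us) x ≡ dnf ts x ∨ dnf us x
  dnf-++ []       us x = refl
  dnf-++ (t ∷ ts) us x with andV (V.map (λ C → val C x) t)
  ... | true  = refl
  ... | false = dnf-++ ts us x

  dnf-map-∷ : ∀ C (ts : Vec (Vec (Circuit n) m) k) x → dnf (V.map (C ∷_) ts) x ≡ val C x ∧ dnf ts x
  dnf-map-∷ C [] x with val C x
  ... | true  = refl
  ... | false = refl
  dnf-map-∷ C (t ∷ ts) x rewrite dnf-map-∷ C ts x with val C x
  ... | true  = refl
  ... | false = refl

  -- Literals are exact, so at `x` only the term of the branch taken by `x` survives, and there the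
  -- leaf decides.
  dnf-terms : ∀ c (ι : Fin (c + m) → Fin n) g h x →
              dnf (terms c ι g h) x ≡ val (g (restrict c h (lookup x ∘ ι))) x
  dnf-terms zero    ι g h       x = trans (∨-identityʳ _) (∧-identityʳ _)
  dnf-terms (suc c) ι g (l , r) x
    rewrite dnf-++ (V.map (gate ¬c (var (ι zero) ∷ []) ∷_) (terms c (ι ∘ suc) g l))
                   (V.map (var (ι zero) ∷_) (terms c (ι ∘ suc) g r) V.++ []) x
          | dnf-++ (V.map (var (ι zero) ∷_) (terms c (ι ∘ suc) g r)) [] x
          | dnf-map-∷ (gate ¬c (var (ι zero) ∷ [])) (terms c (ι ∘ suc) g l) x
          | dnf-map-∷ (var (ι zero)) (terms c (ι ∘ suc) g r) x
          | val-¬var (ι zero) x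
          | val-var (ι zero) x
          | dnf-terms c (ι ∘ suc) g l x
          | dnf-terms c (ι ∘ suc) g r x
    with lookup x (ι zero)
  ... | true  = ∨-identityʳ _
  ... | false = ∨-identityʳ _

  -- The charged gates are `2 ^ c` ANDs and one OR, two levels above the leaves. The leaf depth is
  -- bounded by a successor because the terms also contain negated variables, of depth 1.
  Computes-block : ∀ c {d} (ι : Fin (c + m) → Fin n) g h → (∀ h → depth (g h) ≤ suc d) →
    Computes (3 + d) (suc (2 ^ c * 1)) (block c ι g h)
             (λ x → val (g (restrict c h (lookup x ∘ ι))) x)
  Computes-block c {d} ι g h g≤ = Computes-cong (dnf-terms c ι g h)
    (Computes-join false (join true untested) _ (terms c ι g h)
      (VAll.map (λ {t} ds → weaken (Computes-join true untested val t (VAll.map (Computes-untested _) ds)))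
                (terms-depth c ι g h g≤)))
    where
    weaken : ∀ {d t g} → Computes d (suc ((c + 1) * 0)) t g → Computes d 1 t g
    weaken {d} {t} {g} = subst (λ s → Computes d s t g) (cong suc (*-zeroʳ (c + 1)))

-- Circuits of random functions

functions : ∀ n → List (BF n)
functions zero    = false ∷ true ∷ []
functions (suc n) = cartesianProduct (functions n) (functions n)

-- Translation by `f` permutes the functions: if `h` is uniform, so is `f ⊕ h`.
∑-functions-⊕ : ∀ n (f : BF n) F → ∑ (functions n) (λ h → F (f ⊕ h)) ≡ ∑ (functions n) F
∑-functions-⊕ zero    false   F = refl
∑-functions-⊕ zero    true    F = lemma (F true) (F false)
  where
  lemma : ∀ a b → a + (b + 0) ≡ b + (a + 0)
  lemma = solve-∀
∑-functions-⊕ (suc n) (l , r) F = begin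
  ∑ (functions (suc n)) (λ h → F ((l , r) ⊕ h))
    ≡⟨ ∑-product _,_ (functions n) (functions n) _ ⟩
  ∑ (functions n) (λ h → ∑ (functions n) (λ h′ → F (l ⊕ h , r ⊕ h′)))
    ≡⟨ ∑-cong (functions n) (λ h → ∑-functions-⊕ n r (λ h′ → F (l ⊕ h , h′))) ⟩
  ∑ (functions n) (λ h → ∑ (functions n) (λ h′ → F (l ⊕ h , h′)))
    ≡⟨ ∑-functions-⊕ n l (λ h → ∑ (functions n) (λ h′ → F (h , h′))) ⟩
  ∑ (functions n) (λ h → ∑ (functions n) (λ h′ → F (h , h′)))
    ≡⟨ ∑-product _,_ (functions n) (functions n) F ⟨
  ∑ (functions (suc n)) F ∎
  where open ≡-Reasoning

-- The number of functions of `c + m` variables with a prescribed subfunction along a fixed path of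
-- length `c`: at each branching the half off the path is free.
extensions : ℕ → ℕ → ℕ
extensions zero    m = 1
extensions (suc c) m = length (functions (c + m)) * extensions c m

-- The subfunction met along a fixed path is uniform, each one arising from equally many functions.
∑-functions-restrict : ∀ c v (F : BF m → ℕ) →
  ∑ (functions (c + m)) (λ h → F (restrict c h v)) ≡ extensions c m * ∑ (functions m) F
∑-functions-restrict zero    v F = sym (+-identityʳ _)
∑-functions-restrict {m} (suc c) v F
  rewrite ∑-product _,_ (functions (c + m)) (functions (c + m)) (λ h → F (restrict (suc c) h v))
  with v zero
... | true  = begin
  ∑ fs (λ _ → ∑ fs (λ h → F (restrict c h (v ∘ suc))))         ≡⟨ ∑-const fs _ ⟩
  length fs * ∑ fs (λ h → F (restrict c h (v ∘ suc)))          ≡⟨ cong (length fs *_) (∑-functions-restrict c (v ∘ suc) F) ⟩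
  length fs * (extensions c m * ∑ (functions m) F)             ≡⟨ *-assoc (length fs) (extensions c m) _ ⟨
  length fs * extensions c m * ∑ (functions m) F               ∎
  where
  open ≡-Reasoning
  fs = functions (c + m)
... | false = begin
  ∑ fs (λ h → ∑ fs (λ _ → F (restrict c h (v ∘ suc))))         ≡⟨ ∑-cong fs (λ _ → ∑-const fs _) ⟩
  ∑ fs (λ h → length fs * F (restrict c h (v ∘ suc)))          ≡⟨ ∑-*ˡ fs (length fs) _ ⟩
  length fs * ∑ fs (λ h → F (restrict c h (v ∘ suc)))          ≡⟨ cong (length fs *_) (∑-functions-restrict c (v ∘ suc) F) ⟩
  length fs * (extensions c m * ∑ (functions m) F)             ≡⟨ *-assoc (length fs) (extensions c m) _ ⟨
  length fs * extensions c m * ∑ (functions m) F               ∎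
  where
  open ≡-Reasoning
  fs = functions (c + m)

length-functions-+ : ∀ c m → length (functions (c + m)) ≡ extensions c m * length (functions m)
length-functions-+ c m = begin
  length (functions (c + m))                     ≡⟨ length≡∑1 (functions (c + m)) ⟩
  ∑ (functions (c + m)) (λ _ → 1)                ≡⟨ ∑-functions-restrict {m} c (λ _ → true) (λ _ → 1) ⟩
  extensions c m * ∑ (functions m) (λ _ → 1)     ≡⟨ cong (extensions c m *_) (length≡∑1 (functions m)) ⟨
  extensions c m * length (functions m)          ∎
  where open ≡-Reasoning

functions-nonempty : ∀ n → 0 < length (functions n)
functions-nonempty zero    = s≤s z≤n
functions-nonempty (suc n) = subst (0 <_) (sym eq) (*-mono-< (functions-nonempty n) (functions-nonempty n))
  where
  open ≡-Reasoning
  fs = functions n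
  eq : length (functions (suc n)) ≡ length fs * length fs
  eq = begin
    length (functions (suc n))           ≡⟨ length≡∑1 (functions (suc n)) ⟩
    ∑ (functions (suc n)) (λ _ → 1)      ≡⟨ ∑-product _,_ fs fs _ ⟩
    ∑ fs (λ _ → ∑ fs (λ _ → 1))          ≡⟨ ∑-const fs _ ⟩
    length fs * ∑ fs (λ _ → 1)           ≡⟨ cong (length fs *_) (length≡∑1 fs) ⟨
    length fs * length fs                ∎

∑-concat-replicate : ∀ w (xs : List A) F → ∑ (concat (replicate w xs)) F ≡ w * ∑ xs F
∑-concat-replicate zero    xs F = refl
∑-concat-replicate (suc w) xs F = trans (∑-++ xs _ F) (cong (∑ xs F +_) (∑-concat-replicate w xs F))

circuit : ∀ cs → (Fin (sum cs) → Fin n) → BF (sum cs) → Circuit n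
circuit []       ι h = const h
circuit (c ∷ cs) ι h = proj₁ (block c ι (circuit cs (ι ∘ (c ↑ʳ_))) h)

-- The multiplicities give each of the blocks the same total weight.
block-tests : ∀ cs → (Fin (sum cs) → Fin n) → List (List (Tuple n))
block-tests []       ι = []
block-tests (c ∷ cs) ι =
  map (λ h → proj₂ (block c ι (circuit cs (ι ∘ (c ↑ʳ_))) h)) (functions (c + sum cs)) ++
  concat (replicate (extensions c (sum cs)) (block-tests cs (ι ∘ (c ↑ʳ_))))

length-block-tests : ∀ cs (ι : Fin (sum cs) → Fin n) →
                     length (block-tests cs ι) ≡ length cs * length (functions (sum cs))
length-block-tests []       ι = refl
length-block-tests (c ∷ cs) ι = begin
  length (block-tests (c ∷ cs) ι)                     ≡⟨ length≡∑1 (block-tests (c ∷ cs) ι) ⟩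
  ∑ (block-tests (c ∷ cs) ι) (λ _ → 1)                ≡⟨ ∑-++ (map _ fs) _ _ ⟩
  ∑ (map _ fs) (λ _ → 1) + ∑ (concat (replicate w ts)) (λ _ → 1)
    ≡⟨ cong₂ _+_ (∑-map _ fs _) (∑-concat-replicate w ts _) ⟩
  ∑ fs (λ _ → 1) + w * ∑ ts (λ _ → 1)                 ≡⟨ cong₂ (λ p q → p + w * q) (length≡∑1 fs) (length≡∑1 ts) ⟨
  length fs + w * length ts                           ≡⟨ cong (λ q → length fs + w * q) (length-block-tests cs (ι ∘ (c ↑ʳ_))) ⟩
  length fs + w * (length cs * length (functions (sum cs))) ≡⟨ cong (length fs +_) (x∙yz≈y∙xz w (length cs) _) ⟩
  length fs + length cs * (w * length (functions (sum cs))) ≡⟨ cong (λ q → length fs + length cs * q) (length-functions-+ c (sum cs)) ⟨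
  length fs + length cs * length fs                   ∎
  where
  open ≡-Reasoning
  fs = functions (c + sum cs)
  w = extensions c (sum cs)
  ts = block-tests cs (ι ∘ (c ↑ʳ_))

∈-replicate⁻ : ∀ {y z : A} k → y ∈ replicate k z → y ≡ z
∈-replicate⁻ (suc k) (here eq)  = eq
∈-replicate⁻ (suc k) (there y∈) = ∈-replicate⁻ k y∈

any-true : ∀ (p : A → Bool) xs → any p xs ≡ true → Any (λ a → p a ≡ true) xs
any-true p (x ∷ xs) eq with p x in px
... | true  = here px
... | false = there (any-true p xs eq)

any-false : ∀ (p : A → Bool) xs → any p xs ≡ false → All (λ a → p a ≡ false) xs
any-false p []       eq = []
any-false p (x ∷ xs) eq with p x in px
... | false = px ∷ any-false p xs eq

module Sampling {n : ℕ} (M : Model n) where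
  open Evaluation M
  open Block M

  dirty : Point → List (Tuple n) → Bool
  dirty x = any (err x)

  wrong : ∀ cs → (Fin (sum cs) → Fin n) → Point → BF (sum cs) → Bool
  wrong cs ι x h = val (circuit cs ι h) x xor eval h (lookup x ∘ ι)

  -- Each block adds an OR of ANDs; the extra 1 leaves room for the negated variables and is paid
  -- only once.
  circuit-depth : ∀ cs (ι : Fin (sum cs) → Fin n) h → depth (circuit cs ι h) ≤ suc (2 * length cs)
  circuit-depth []       ι h = z≤n
  circuit-depth (c ∷ cs) ι h =
    subst (λ d → depth (circuit (c ∷ cs) ι h) ≤ suc d) (sym (*-suc 2 (length cs)))
      (depth≤ (Computes-block c ι _ h (circuit-depth cs (ι ∘ (c ↑ʳ_)))))

  -- A union bound along the path of `x`: if the gates of the first block make no error at `x`, the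
  -- circuit can be wrong only if the circuit of the subfunction reached is wrong. That subfunction
  -- is again uniform, so induction applies with weight `extensions`.
  ∑-wrong≤ : ∀ cs (ι : Fin (sum cs) → Fin n) x →
             ∑ (functions (sum cs)) (λ h → ⟦ wrong cs ι x h ⟧) ≤ ∑ (block-tests cs ι) (λ ts → ⟦ dirty x ts ⟧)
  ∑-wrong≤ []       ι x = ≤-reflexive (cong₂ (λ p q → p + (q + 0)) (constant false) (constant true))
    where
    constant : ∀ b → ⟦ wrong [] ι x b ⟧ ≡ 0
    constant b rewrite eval-const n b (lookup x) | xor-same b = refl
  ∑-wrong≤ (c ∷ cs) ι x = begin
    ∑ fs (λ h → ⟦ wrong (c ∷ cs) ι x h ⟧)
      ≤⟨ ∑-mono fs pointwise ⟩
    ∑ fs (λ h → ⟦ dirty x (proj₂ (blk h)) ⟧ + ⟦ wrong cs ι′ x (restrict c h v) ⟧)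
      ≡⟨ ∑-+ fs _ _ ⟩
    ∑ fs (λ h → ⟦ dirty x (proj₂ (blk h)) ⟧) + ∑ fs (λ h → ⟦ wrong cs ι′ x (restrict c h v) ⟧)
      ≡⟨ cong₂ _+_ (sym (∑-map (proj₂ ∘ blk) fs _)) (∑-functions-restrict c v (λ h → ⟦ wrong cs ι′ x h ⟧)) ⟩
    ∑ (map (proj₂ ∘ blk) fs) (λ ts → ⟦ dirty x ts ⟧) + w * ∑ (functions (sum cs)) (λ h → ⟦ wrong cs ι′ x h ⟧)
      ≤⟨ +-monoʳ-≤ _ (*-monoʳ-≤ w (∑-wrong≤ cs ι′ x)) ⟩
    ∑ (map (proj₂ ∘ blk) fs) (λ ts → ⟦ dirty x ts ⟧) + w * ∑ (block-tests cs ι′) (λ ts → ⟦ dirty x ts ⟧)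
      ≡⟨ cong (∑ (map (proj₂ ∘ blk) fs) (λ ts → ⟦ dirty x ts ⟧) +_) (∑-concat-replicate w (block-tests cs ι′) _) ⟨
    ∑ (map (proj₂ ∘ blk) fs) (λ ts → ⟦ dirty x ts ⟧) + ∑ (concat (replicate w (block-tests cs ι′))) (λ ts → ⟦ dirty x ts ⟧)
      ≡⟨ ∑-++ (map (proj₂ ∘ blk) fs) _ _ ⟨
    ∑ (block-tests (c ∷ cs) ι) (λ ts → ⟦ dirty x ts ⟧) ∎
    where
    open ≤-Reasoning
    fs = functions (c + sum cs)
    w = extensions c (sum cs)
    ι′ = ι ∘ (c ↑ʳ_)
    v = lookup x ∘ ι
    blk = block c ι (circuit cs ι′)
    ⟦⟧≤1 : ∀ b → ⟦ b ⟧ ≤ 1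
    ⟦⟧≤1 true  = s≤s z≤n
    ⟦⟧≤1 false = z≤n
    pointwise : ∀ h → ⟦ wrong (c ∷ cs) ι x h ⟧ ≤ ⟦ dirty x (proj₂ (blk h)) ⟧ + ⟦ wrong cs ι′ x (restrict c h v) ⟧
    pointwise h with dirty x (proj₂ (blk h)) in eq
    ... | true  = ≤-trans (⟦⟧≤1 _) (s≤s z≤n)
    ... | false = ≤-reflexive (cong ⟦_⟧ (cong₂ _xor_
      (correct (Computes-block c ι _ h (circuit-depth cs ι′)) x (any-false (err x) _ eq))
      (sym (eval-restrict c h v))))

  Affordable : ℕ → ℕ → List (Tuple n) → Set
  Affordable d s ts = length ts ≤ s × All (λ tp → arg-depth tp < d) ts

  block-tests-affordable : ∀ cs (ι : Fin (sum cs) → Fin n) b {d} → All (_≤ b) cs → 2 * length cs < d →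
    ∀ {ts} → ts ∈ block-tests cs ι → Affordable d (2 ^ b + 1) ts
  block-tests-affordable (c ∷ cs) ι b {d} (c≤b ∷ cs≤b) lt ts∈
    with ∈-++⁻ (map (λ h → proj₂ (block c ι (circuit cs (ι ∘ (c ↑ʳ_))) h)) (functions (c + sum cs))) ts∈
  ... | inj₁ ts∈ˡ with ∈-map⁻ _ ts∈ˡ
  ...   | h , _ , refl = ≤-trans (size≤ cb) (≤-trans (≤-reflexive (lemma (2 ^ c))) (+-monoˡ-≤ 1 (^-monoʳ-≤ 2 c≤b)))
                       , All.map (λ p → <-≤-trans p (subst (_≤ d) (cong suc (*-suc 2 (length cs))) lt)) (depths< cb)
    where
    cb = Computes-block c ι _ h (circuit-depth cs (ι ∘ (c ↑ʳ_)))
    lemma : ∀ p → suc (p * 1) ≡ p + 1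
    lemma = solve-∀
  block-tests-affordable (c ∷ cs) ι b {d} (c≤b ∷ cs≤b) lt ts∈ | inj₂ ts∈ʳ
    with ∈-concat⁻′ (replicate (extensions c (sum cs)) (block-tests cs (ι ∘ (c ↑ʳ_)))) ts∈ʳ
  ... | tss , ts∈tss , tss∈ =
    block-tests-affordable cs (ι ∘ (c ↑ʳ_)) b cs≤b (≤-trans (s≤s (*-monoʳ-≤ 2 (n≤1+n (length cs)))) lt)
      (subst (_ ∈_) (∈-replicate⁻ (extensions c (sum cs)) tss∈) ts∈tss)

-- Amplification

-- Here `f` counts the sequences of `s` draws with at least one bad outcome. If one draw is bad with
-- probability at most `1 / q`, the union bound gives probability at most `s / q`.
tail-bound : ∀ q s z a f → 0 < z + a → q * a ≤ z + a → z ^ s + f ≡ (z + a) ^ s → q * f ≤ s * (z + a) ^ s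
tail-bound q s z a f 0<N qa≤N eq = *-cancelˡ-≤ N {{>-nonZero 0<N}} (begin
  N * (q * f)         ≡⟨ x∙yz≈y∙xz N q f ⟩
  q * (N * f)         ≤⟨ *-monoʳ-≤ q Nf≤ ⟩
  q * (s * a * N ^ s) ≡⟨ lemma q s a (N ^ s) ⟩
  q * a * (s * N ^ s) ≤⟨ *-monoˡ-≤ (s * N ^ s) qa≤N ⟩
  N * (s * N ^ s)     ∎)
  where
  open ≤-Reasoning
  N = z + a
  lemma : ∀ q s a p → q * (s * a * p) ≡ q * a * (s * p)
  lemma = solve-∀
  Nf≤ : N * f ≤ s * a * N ^ s
  Nf≤ = +-cancelˡ-≤ (N * z ^ s) _ _ (begin
    N * z ^ s + N * f             ≡⟨ *-distribˡ-+ N (z ^ s) f ⟨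
    N * (z ^ s + f)               ≡⟨ cong (N *_) eq ⟩
    N * N ^ s                     ≤⟨ union-bound s z a ⟩
    N * z ^ s + s * a * N ^ s     ∎)

scaled-^ : ∀ k c a b → c * a ≤ b → c ^ k * a ^ k ≤ b ^ k
scaled-^ k c a b le = subst (_≤ b ^ k) (^-distribʳ-* k c a) (^-monoˡ-≤ k le)

module Amplification {A X : Set} (R : List A) (e : A → X → Bool) (φ : X → Bool)
  (n l : ℕ) (0<n : 0 < n) (8n≤8^l : 8 * n ≤ 8 ^ l) (0<R : 0 < length R) where

  private
    s : ℕ
    -- If a row accepts with probability at least `2 ^ -l`, then `2 ^ l` rows all reject with
    -- probability at most 1/2, and `2 * n` such groups bring this down to `4 ^ -n`.
    s = 2 ^ l * (2 * n)

    0<s : 0 < s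
    0<s = *-mono-< {0} {2 ^ l} {0} {2 * n} (m^n>0 2 l) (≤-trans 0<n (m≤m+n n _))

  row : Vec A l → X → Bool
  row v x = andV (V.map (λ r → e r x) v)

  column : ∀ {s} → Vec (Vec A l) s → X → Bool
  column w x = orV (V.map (λ v → row v x) w)

  vote : ∀ {s} → Vec (Vec (Vec A l) s) n → X → Bool
  vote u x = andV (V.map (λ w → column w x) u)

  rows    = vectors R l
  columns = vectors rows s
  votes   = vectors columns n

  0<rows : 0 < length rows
  0<rows = subst (0 <_) (sym (length-vectors R l)) (m^n>0 (length R) {{>-nonZero 0<R}} l)

  0<columns : 0 < length columns
  0<columns = subst (0 <_) (sym (length-vectors rows s)) (m^n>0 (length rows) {{>-nonZero 0<rows}} s)

  0<votes : 0 < length votes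
  0<votes = subst (0 <_) (sym (length-vectors columns n)) (m^n>0 (length columns) {{>-nonZero 0<columns}} n)

  Reliable : X → Set
  Reliable x = 16 * ∑ R (λ r → ⟦ e r x xor φ x ⟧) ≤ length R

  module _ (x : X) where
    row⁺ row⁻ column⁺ column⁻ vote⁺ vote⁻ : ℕ
    row⁺    = ∑ rows (λ v → ⟦ row v x ⟧)
    row⁻    = ∑ rows (λ v → ⟦ not (row v x) ⟧)
    column⁺ = ∑ columns (λ v → ⟦ column v x ⟧)
    column⁻ = ∑ columns (λ v → ⟦ not (column v x) ⟧)
    vote⁺   = ∑ votes (λ v → ⟦ vote v x ⟧)
    vote⁻   = ∑ votes (λ v → ⟦ not (vote v x) ⟧)

    rows± : row⁻ + row⁺ ≡ length rows
    rows± = ∑-not rows (λ v → row v x)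

    columns± : column⁻ + column⁺ ≡ length columns
    columns± = ∑-not columns (λ v → column v x)

    votes± : vote⁻ + vote⁺ ≡ length votes
    votes± = ∑-not votes (λ v → vote v x)

    column⁻≡ : column⁻ ≡ row⁻ ^ s
    column⁻≡ = ∑-not-orV rows (λ v → row v x) s

    vote⁺≡ : vote⁺ ≡ column⁺ ^ n
    vote⁺≡ = ∑-andV columns (λ w → column w x) n

    row⁺≡ : row⁺ ≡ ∑ R (λ r → ⟦ e r x ⟧) ^ l
    row⁺≡ = ∑-andV R (λ r → e r x) l

    -- A row accepts with probability at most `16 ^ -l`, hence a column with at most
    -- `s / 16 ^ l ≤ 1/4`, and all `n` columns with at most `4 ^ -n`.
    rejects : 16 * ∑ R (λ r → ⟦ e r x ⟧) ≤ length R → 2 ^ n * (2 ^ n * vote⁺) ≤ n * length votes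
    rejects le = begin
      2 ^ n * (2 ^ n * vote⁺)      ≡⟨ *-assoc (2 ^ n) (2 ^ n) vote⁺ ⟨
      2 ^ n * 2 ^ n * vote⁺        ≡⟨ cong₂ _*_ (sym (^-distribʳ-* n 2 2)) vote⁺≡ ⟩
      4 ^ n * column⁺ ^ n          ≤⟨ scaled-^ n 4 column⁺ (length columns) 4column⁺≤ ⟩
      length columns ^ n           ≡⟨ length-vectors columns n ⟨
      -- The factor `n` is added only to give the bound the shape of `accepts`.
      length votes                 ≤⟨ m≤n*m (length votes) n {{>-nonZero 0<n}} ⟩
      n * length votes             ∎
      where
      open ≤-Reasoning
      16^row⁺≤ : 16 ^ l * row⁺ ≤ row⁻ + row⁺
      16^row⁺≤ = begin
        16 ^ l * row⁺                            ≡⟨ cong (16 ^ l *_) row⁺≡ ⟩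
        16 ^ l * ∑ R (λ r → ⟦ e r x ⟧) ^ l       ≤⟨ scaled-^ l 16 _ (length R) le ⟩
        length R ^ l                             ≡⟨ length-vectors R l ⟨
        length rows                              ≡⟨ rows± ⟨
        row⁻ + row⁺                              ∎
      4s≤16^l : 4 * s ≤ 16 ^ l
      4s≤16^l = begin
        4 * (2 ^ l * (2 * n))  ≡⟨ lemma (2 ^ l) n ⟩
        8 * n * 2 ^ l          ≤⟨ *-monoˡ-≤ (2 ^ l) 8n≤8^l ⟩
        8 ^ l * 2 ^ l          ≡⟨ ^-distribʳ-* l 8 2 ⟨
        16 ^ l                 ∎
        where
        lemma : ∀ p n → 4 * (p * (2 * n)) ≡ 8 * n * p
        lemma = solve-∀
      rows^s : (row⁻ + row⁺) ^ s ≡ length columns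
      rows^s = trans (cong (_^ s) rows±) (sym (length-vectors rows s))
      4column⁺≤ : 4 * column⁺ ≤ length columns
      4column⁺≤ = *-cancelˡ-≤ s {{>-nonZero 0<s}} (begin
        s * (4 * column⁺)      ≡⟨ x∙yz≈yx∙z s 4 column⁺ ⟩
        4 * s * column⁺        ≤⟨ *-monoˡ-≤ column⁺ 4s≤16^l ⟩
        16 ^ l * column⁺       ≤⟨ tail-bound (16 ^ l) s row⁻ row⁺ column⁺ (subst (0 <_) (sym rows±) 0<rows) 16^row⁺≤
                                    (trans (cong (_+ column⁺) (sym column⁻≡)) (trans columns± (sym rows^s))) ⟩
        s * (row⁻ + row⁺) ^ s  ≡⟨ cong (s *_) rows^s ⟩
        s * length columns     ∎)

    -- Since `e` accepts with probability at least 1/2, a row does so with at least `2 ^ -l`. By the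
    -- choice of `s` a column then rejects with probability at most `4 ^ -n`, and some column among
    -- `n` does with at most `n / 4 ^ n`.
    accepts : 16 * ∑ R (λ r → ⟦ not (e r x) ⟧) ≤ length R → 2 ^ n * (2 ^ n * vote⁻) ≤ n * length votes
    accepts le = begin
      2 ^ n * (2 ^ n * vote⁻)       ≡⟨ *-assoc (2 ^ n) (2 ^ n) vote⁻ ⟨
      2 ^ n * 2 ^ n * vote⁻         ≡⟨ cong (_* vote⁻) 2^2n ⟨
      2 ^ (2 * n) * vote⁻           ≤⟨ tail-bound (2 ^ (2 * n)) n column⁺ column⁻ vote⁻ (subst (0 <_) (sym columns∓) 0<columns)
                                         (≤-trans column⁻≤ (≤-reflexive (sym columns∓)))
                                         (trans (cong (_+ vote⁻) (sym vote⁺≡)) (trans (+-comm vote⁺ vote⁻) (trans votes± (sym columns^n)))) ⟩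
      n * (column⁺ + column⁻) ^ n   ≡⟨ cong (n *_) columns^n ⟩
      n * length votes              ∎
      where
      open ≤-Reasoning
      2^2n : 2 ^ (2 * n) ≡ 2 ^ n * 2 ^ n
      2^2n = trans (cong (λ m → 2 ^ (n + m)) (+-identityʳ n)) (^-distribˡ-+-* 2 n n)
      columns∓ : column⁺ + column⁻ ≡ length columns
      columns∓ = trans (+-comm column⁺ column⁻) columns±
      columns^n : (column⁺ + column⁻) ^ n ≡ length votes
      columns^n = trans (cong (_^ n) columns∓) (sym (length-vectors columns n))
      a b : ℕ
      a = ∑ R (λ r → ⟦ e r x ⟧)
      b = ∑ R (λ r → ⟦ not (e r x) ⟧)
      b+a : b + a ≡ length R
      b+a = ∑-not R (λ r → e r x)
      b≤a : b ≤ a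
      b≤a = +-cancelˡ-≤ b b a (≤-trans (m≤m+n (b + b) (14 * b)) (≤-trans (≤-reflexive (lemma b)) (subst (16 * b ≤_) (sym b+a) le)))
        where
        lemma : ∀ b → b + b + 14 * b ≡ 16 * b
        lemma = solve-∀
      row⁻≤ : row⁻ ≤ 2 ^ l * row⁺
      row⁻≤ = begin
        row⁻             ≤⟨ m≤m+n row⁻ row⁺ ⟩
        row⁻ + row⁺      ≡⟨ rows± ⟩
        length rows      ≡⟨ length-vectors R l ⟩
        length R ^ l     ≡⟨ cong (_^ l) b+a ⟨
        (b + a) ^ l      ≤⟨ ^-monoˡ-≤ l (+-mono-≤ b≤a (≤-reflexive (sym (+-identityʳ a)))) ⟩
        (2 * a) ^ l      ≡⟨ ^-distribʳ-* l 2 a ⟩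
        2 ^ l * a ^ l    ≡⟨ cong (2 ^ l *_) row⁺≡ ⟨
        2 ^ l * row⁺     ∎
      column⁻≤ : 2 ^ (2 * n) * column⁻ ≤ length columns
      column⁻≤ = begin
        2 ^ (2 * n) * column⁻                   ≡⟨ cong (2 ^ (2 * n) *_) (trans column⁻≡ (sym (^-*-assoc row⁻ (2 ^ l) (2 * n)))) ⟩
        2 ^ (2 * n) * (row⁻ ^ (2 ^ l)) ^ (2 * n)
          ≤⟨ scaled-^ (2 * n) 2 (row⁻ ^ (2 ^ l)) _ (2z^k≤[z+a]^k (2 ^ l) row⁻ row⁺ (m^n>0 2 l) row⁻≤) ⟩
        ((row⁻ + row⁺) ^ (2 ^ l)) ^ (2 * n)     ≡⟨ ^-*-assoc (row⁻ + row⁺) (2 ^ l) (2 * n) ⟩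
        (row⁻ + row⁺) ^ s                       ≡⟨ cong (_^ s) rows± ⟩
        length rows ^ s                         ≡⟨ length-vectors rows s ⟨
        length columns                          ∎

    -- In both cases the error is at most `n / 4 ^ n`, which is below `2 ^ -n` because `n < 2 ^ n`.
    failure : Reliable x → 2 ^ n * ∑ votes (λ u → ⟦ vote u x xor φ x ⟧) < length votes
    failure rel = *-cancelˡ-< (2 ^ n) _ _ (≤-<-trans (go (φ x) rel)
                    (*-monoˡ-< (length votes) {{>-nonZero 0<votes}} (n<2^n n)))
      where
      xor-false : ∀ b → b xor false ≡ b
      xor-false true  = refl
      xor-false false = refl
      xor-true : ∀ b → b xor true ≡ not b
      xor-true true  = refl
      xor-true false = refl
      go : ∀ y → 16 * ∑ R (λ r → ⟦ e r x xor y ⟧) ≤ length R →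
           2 ^ n * (2 ^ n * ∑ votes (λ u → ⟦ vote u x xor y ⟧)) ≤ n * length votes
      go true  le rewrite ∑-cong votes (λ u → cong ⟦_⟧ (xor-true (vote u x)))
                        | ∑-cong R (λ r → cong ⟦_⟧ (xor-true (e r x))) = accepts le
      go false le rewrite ∑-cong votes (λ u → cong ⟦_⟧ (xor-false (vote u x)))
                        | ∑-cong R (λ r → cong ⟦_⟧ (xor-false (e r x))) = rejects le

  -- The expected number of points of `U` with a wrong vote is below 1, so some choice of samples
  -- has none.
  amplify : ∀ U → length U ≤ 2 ^ n → (∀ {x} → x ∈ U → Reliable x) →
            ∃ λ (u : Vec (Vec (Vec A l) s) n) → ∀ {x} → x ∈ U → vote u x ≡ φ x
  amplify U |U|≤ rel = proj₁ good , λ {x} x∈U → xor≡0 (∑≡0⇒≡0 (proj₂ good) x∈U)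
    where
    xor≡0 : ∀ {a b} → ⟦ a xor b ⟧ ≡ 0 → a ≡ b
    xor≡0 {true}  {true}  _ = refl
    xor≡0 {false} {false} _ = refl
    good = averaging-zero votes (λ u → ∑ U (λ x → ⟦ vote u x xor φ x ⟧))
      (subst (_< length votes) (∑-swap U votes _)
        (∑-scaled-< U _ (2 ^ n) (length votes) 0<votes |U|≤ (λ {x} x∈U → failure x (rel x∈U))))

-- Masking, covering and voting combined

true≢false : true ≢ false
true≢false ()

-- Makes `xor-mask` provable by evaluating its 64 cases.
∀Bool? : {P : Bool → Set} → (∀ b → Dec (P b)) → Dec (∀ b → P b)
∀Bool? P? with P? true | P? false
... | yes p | yes q = yes λ { true → p ; false → q }
... | no ¬p | _     = no λ f → ¬p (f true)
... | _     | no ¬q = no λ f → ¬q (f false)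

-- φ = (ρ ∧ ¬(φ xor ρ)) ∨ (¬ρ ∧ (φ xor ρ)); a, b, c, d stand for possibly wrong values of the four literals.
xor-mask : ∀ φ ρ a b c d →
  ⟦ (orV (andV (a ∷ b ∷ []) ∷ andV (c ∷ d ∷ []) ∷ [])) xor φ ⟧ ≤
  ⟦ a xor ρ ⟧ + ⟦ b xor (true xor (φ xor ρ)) ⟧ + (⟦ c xor (true xor ρ) ⟧ + ⟦ d xor (φ xor ρ) ⟧)
xor-mask = toWitness {a? = ∀Bool? λ φ → ∀Bool? λ ρ → ∀Bool? λ a → ∀Bool? λ b → ∀Bool? λ c → ∀Bool? λ d → _ ≤? _} tt

bits-complete : ∀ (x : Vec Bool n) → x ∈ vectors (true ∷ false ∷ []) n
bits-complete []      = here refl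
bits-complete (b ∷ x) = ∈-cartesianProductWith⁺ _∷_ (bit b) (bits-complete x)
  where
  bit : ∀ b → b ∈ true ∷ false ∷ []
  bit true  = here refl
  bit false = there (here refl)

length-concat≤ : ∀ s {xss : List (List A)} → All (λ xs → length xs ≤ s) xss → length (concat xss) ≤ length xss * s
length-concat≤ s []                     = z≤n
length-concat≤ s (_∷_ {x = xs} le les) = ≤-trans (≤-reflexive (length-++ xs)) (+-mono-≤ le (length-concat≤ s les))

module Approximation (c : ℕ) (cs′ : List ℕ) where

  cs : List ℕ
  cs = c ∷ cs′

  n₀ : ℕ
  n₀ = sum cs

  module Sized (M : Model n₀) (f : BF n₀) (b d l : ℕ) (cs≤b : All (_≤ b) cs) (8*|cs|≤d : 8 * length cs ≤ d)
           (0<n : 0 < n₀) (8n≤8^l : 8 * n₀ ≤ 8 ^ l) (a : ℕ) (1+a≡64*|cs| : suc a ≡ 64 * length cs) where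
    open Evaluation M
    open Sampling M

    N : ℕ
    N = length (functions n₀)

    D : BF n₀ → Circuit n₀
    D = circuit cs id

    neg : BF n₀ → BF n₀
    neg h = constBF true ⊕ h

    -- Complements are taken on functions and not by gates: all four entries are then `D` of a
    -- uniform function, to which the same error bound applies.
    masked : BF n₀ → Vec (Vec (Circuit n₀) 2) 2
    masked r = (D r ∷ D (neg (f ⊕ r)) ∷ []) ∷ (D (neg r) ∷ D (f ⊕ r) ∷ []) ∷ []

    unmasked : BF n₀ → Point → Bool
    unmasked r x = orV (V.map (λ t → andV (V.map (λ C → val C x) t)) (masked r))

    unmask : BF n₀ → Tested n₀
    unmask r = join false (join true untested) (masked r)

    D-depth : ∀ h → depth (D h) ≤ suc (2 * length cs)
    D-depth = circuit-depth cs id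

    Computes-unmask : ∀ r → Computes (3 + 2 * length cs) 3 (unmask r) (unmasked r)
    Computes-unmask r = Computes-join false (join true untested)
      (λ t x → andV (V.map (λ C → val C x) t)) (masked r) (pair _ _ ∷ pair _ _ ∷ [])
      where
      pair : ∀ g h → Computes (2 + 2 * length cs) 1 (join true untested (D g ∷ D h ∷ []))
                              (λ x → andV (V.map (λ C → val C x) (D g ∷ D h ∷ [])))
      pair g h = Computes-join true untested val (D g ∷ D h ∷ [])
        (Computes-untested _ (D-depth g) ∷ Computes-untested _ (D-depth h) ∷ [])

    wrongs : Point → ℕ
    wrongs x = ∑ (functions n₀) (λ h → ⟦ wrong cs id x h ⟧)

    -- By `xor-mask` an error of the combination is an error of one of the four circuits. Their
    -- functions are each uniform, though not independent, and a union bound asks for no more.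
    ∑-unmasked≤ : ∀ x → ∑ (functions n₀) (λ r → ⟦ unmasked r x xor eval f (lookup x) ⟧) ≤ 4 * wrongs x
    ∑-unmasked≤ x = begin
      ∑ fs (λ r → ⟦ unmasked r x xor eval f v ⟧)
        ≤⟨ ∑-mono fs pointwise ⟩
      ∑ fs (λ r → w r + w (neg (f ⊕ r)) + (w (neg r) + w (f ⊕ r)))
        ≡⟨ trans (∑-+ fs _ _) (cong₂ _+_ (∑-+ fs _ _) (∑-+ fs _ _)) ⟩
      ∑ fs w + ∑ fs (λ r → w (neg (f ⊕ r))) + (∑ fs (λ r → w (neg r)) + ∑ fs (λ r → w (f ⊕ r)))
        ≡⟨ cong₂ _+_ (cong (∑ fs w +_) (trans (∑-functions-⊕ n₀ f (w ∘ neg)) (∑-functions-⊕ n₀ (constBF true) w)))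
                     (cong₂ _+_ (∑-functions-⊕ n₀ (constBF true) w) (∑-functions-⊕ n₀ f w)) ⟩
      wrongs x + wrongs x + (wrongs x + wrongs x)
        ≡⟨ lemma (wrongs x) ⟩
      4 * wrongs x ∎
      where
      open ≤-Reasoning
      fs = functions n₀
      v = lookup x
      w : BF n₀ → ℕ
      w h = ⟦ wrong cs id x h ⟧
      lemma : ∀ p → p + p + (p + p) ≡ 4 * p
      lemma = solve-∀
      eval-neg : ∀ h → eval (neg h) v ≡ true xor eval h v
      eval-neg h = trans (eval-⊕ (constBF true) h v) (cong (_xor eval h v) (eval-const n₀ true v))
      pointwise : ∀ r → ⟦ unmasked r x xor eval f v ⟧ ≤ w r + w (neg (f ⊕ r)) + (w (neg r) + w (f ⊕ r))
      pointwise r rewrite eval-neg r | eval-neg (f ⊕ r) | eval-⊕ f r v =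
        xor-mask (eval f v) (eval r v) (val (D r) x) (val (D (neg (f ⊕ r))) x) (val (D (neg r)) x) (val (D (f ⊕ r)) x)

    tests : List (List (Tuple n₀))
    tests = block-tests cs id

    open Greedy tests (λ ts x → dirty x ts) a
      (subst (0 <_) (sym (length-block-tests cs id)) (≤-trans (functions-nonempty n₀) (m≤m+n N _)))
    open Amplification (functions n₀) unmasked (λ x → eval f (lookup x)) n₀ l 0<n 8n≤8^l (functions-nonempty n₀)

    -- There are `length cs * N` tests, and at most a `1 / (64 * length cs)` fraction of them hits
    -- `x`. Hence `D` is wrong at `x` for at most `N / 64` functions, and four uses give 4/64 =
    -- 1/16.
    ¬rich⇒reliable : ∀ {x} → ¬ Rich x → Reliable x
    ¬rich⇒reliable {x} ¬rich = begin
      16 * ∑ (functions n₀) (λ r → ⟦ unmasked r x xor eval f (lookup x) ⟧) ≤⟨ *-monoʳ-≤ 16 (∑-unmasked≤ x) ⟩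
      16 * (4 * wrongs x)                                                ≡⟨ *-assoc 16 4 (wrongs x) ⟨
      64 * wrongs x                                                      ≤⟨ *-cancelˡ-≤ (length cs) scaled ⟩
      N                                                             ∎
      where
      open ≤-Reasoning
      lemma : ∀ p q → p * (64 * q) ≡ 64 * p * q
      lemma = solve-∀
      scaled : length cs * (64 * wrongs x) ≤ length cs * N
      scaled = begin
        length cs * (64 * wrongs x)                                ≡⟨ lemma (length cs) (wrongs x) ⟩
        64 * length cs * wrongs x                                  ≤⟨ *-monoʳ-≤ (64 * length cs) (∑-wrong≤ cs id x) ⟩
        64 * length cs * ∑ tests (λ ts → ⟦ dirty x ts ⟧)      ≡⟨ cong (_* ∑ tests (λ ts → ⟦ dirty x ts ⟧)) 1+a≡64*|cs| ⟨
        suc a * ∑ tests (λ ts → ⟦ dirty x ts ⟧)               ≤⟨ ≰⇒≥ ¬rich ⟩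
        length tests                                          ≡⟨ length-block-tests cs id ⟩
        length cs * N                                         ∎

    points : List Point
    points = vectors (true ∷ false ∷ []) n₀

    rich? : ∀ x → Dec (Rich x)
    rich? x = _ ≤? _

    |points| : length points ≡ 2 ^ n₀
    |points| = length-vectors (true ∷ false ∷ []) n₀

    -- The exponent is `suc n₀` because `cover` asks for strictly fewer than `2 ^ k` points, and all
    -- `2 ^ n₀` may be rich.
    covering = cover (suc n₀) (filter rich? points)
      (≤-<-trans (≤-trans (length-filter rich? points) (≤-reflexive |points|)) (^-monoʳ-< 2 (s≤s (s≤s z≤n)) (n<1+n n₀)))
      (proj₂ ∘ ∈-filter⁻ rich? {xs = points})

    voting = amplify (filter (¬? ∘ rich?) points)
      (≤-trans (length-filter (¬? ∘ rich?) points) (≤-reflexive |points|))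
      (λ {x} x∈ → ¬rich⇒reliable {x} (proj₂ (∈-filter⁻ (¬? ∘ rich?) {xs = points} x∈)))

    u = proj₁ voting

    top : Tested n₀
    top = join true (join false (join true unmask)) u

    top-size : ℕ
    top-size = suc (n₀ * suc (2 ^ l * (2 * n₀) * suc (l * 3)))

    Computes-top : Computes (6 + 2 * length cs) top-size top (vote u)
    Computes-top =
      Computes-join true _ (λ w x → column w x) u (VAll.universal (λ w →
        Computes-join false _ (λ v x → row v x) w (VAll.universal (λ v →
          Computes-join true unmask unmasked v (VAll.universal Computes-unmask v)) w)) u)

    chosen-tests : List (List (Tuple n₀))
    chosen-tests = proj₁ covering

    affordable : All (Affordable d (2 ^ b + 1)) chosen-tests
    affordable = All.map (block-tests-affordable cs id b cs≤b 2*|cs|<d) (proj₁ (proj₂ (proj₂ covering)))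
      where
      2*|cs|<d : 2 * length cs < d
      2*|cs|<d = ≤-trans (*-monoˡ-< (length cs) {2} {8} (s≤s (s≤s (s≤s z≤n)))) 8*|cs|≤d

    -- The reason for `d / 8`: `D` has depth at most `1 + 2 * length cs`, masking adds 2 and voting
    -- 3. With at least one block the total is at most `8 * length cs`.
    6+2*|cs|≤d : 6 + 2 * length cs ≤ d
    6+2*|cs|≤d = ≤-trans (≤-trans (+-monoˡ-≤ (2 * length cs) (m≤m*n 6 (length cs)))
                           (≤-reflexive (sym (*-distribʳ-+ (length cs) 6 2)))) 8*|cs|≤d

    budget : ℕ
    budget = suc n₀ * suc a * (2 ^ b + 1) + top-size

    all-tests : List (Tuple n₀)
    all-tests = concat chosen-tests ++ proj₂ top

    all-tests-size : length all-tests ≤ budget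
    all-tests-size = begin
      length all-tests                                            ≡⟨ length-++ (concat chosen-tests) ⟩
      length (concat chosen-tests) + length (proj₂ top)           ≤⟨ +-mono-≤ (length-concat≤ (2 ^ b + 1) (All.map proj₁ affordable))
                                                                              (size≤ Computes-top) ⟩
      length chosen-tests * (2 ^ b + 1) + top-size                ≡⟨ cong (λ k → k * (2 ^ b + 1) + top-size) (proj₁ (proj₂ covering)) ⟩
      budget                                                      ∎
      where open ≤-Reasoning

    all-tests-depth : All (λ tp → arg-depth tp < d) all-tests
    all-tests-depth = All.++⁺ (All.concat⁺ (All.map proj₂ affordable))
                              (All.map (λ p → <-≤-trans p 6+2*|cs|≤d) (depths< Computes-top))

    approximation : ρ≤ M f d budget
    approximation =
        proj₁ top
      , ≤-trans (depth≤ Computes-top) 6+2*|cs|≤d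
      , all-tests
      , all-tests-size
      , All.map <⇒≤pred all-tests-depth
      , covers
      where
      covers : ∀ v → eval (f ⊕ proj₁ (approx M (proj₁ top))) v ≡ true →
               Any (λ tp → eval (δ M (proj₁ (proj₂ tp)) (approxV M (proj₂ (proj₂ tp)))) v ≡ true)
                   all-tests
      covers v differs = Any.map (λ {tp} → trans (eval-cong (δ M (proj₁ (proj₂ tp)) (approxV M (proj₂ (proj₂ tp)))) v≗x))
        (found (rich? x) _ refl)
        where
        x = V.tabulate v
        v≗x : v ≗ lookup x
        v≗x i = sym (V.lookup∘tabulate v i)
        wrong-at-x : val (proj₁ top) x ≢ eval f (lookup x)
        wrong-at-x eq = true≢false (trans (sym differs)
          (trans (eval-cong (f ⊕ proj₁ (approx M (proj₁ top))) v≗x)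
            (trans (eval-⊕ f _ (lookup x)) (trans (cong (eval f (lookup x) xor_) eq) (xor-same (eval f (lookup x)))))))
        -- A rich point lies in an error set of a chosen block. At any other point either a gate of
        -- `top` errs, or `top` returns the vote, which equals `f` there and contradicts the
        -- difference at `v`.
        found : Dec (Rich x) → ∀ b → dirty x (proj₂ top) ≡ b →
                Any (λ tp → err x tp ≡ true) all-tests
        found (yes rich) _     _  = Any.++⁺ˡ (Any.concat⁺ (Any.map (any-true (err x) _)
                                      (proj₂ (proj₂ (proj₂ covering)) (∈-filter⁺ rich? (bits-complete x) rich))))
        found (no ¬rich) true  eq = Any.++⁺ʳ (concat chosen-tests) (any-true (err x) _ eq)
        found (no ¬rich) false eq = ⊥-elim (wrong-at-x (trans (correct Computes-top x (any-false (err x) _ eq))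
                                      (proj₂ voting (∈-filter⁺ (¬? ∘ rich?) (bits-complete x) ¬rich))))

-- Choice of the blocks and numerical estimates

blocks : ∀ B b n → n ≤ B * b → ∃ λ cs → sum cs ≡ n × length cs ≤ B × All (_≤ b) cs
blocks zero    b zero z≤n = [] , refl , z≤n , []
blocks (suc B) b n le with n ≤? b
... | yes n≤b = n ∷ [] , +-identityʳ n , s≤s z≤n , n≤b ∷ []
... | no n≰b  =
  let cs , eq , |cs|≤B , cs≤b = blocks B b (n ∸ b) (≤-trans (∸-monoˡ-≤ b le) (≤-reflexive (m+n∸m≡n b (B * b))))
  in  b ∷ cs , trans (cong (b +_) eq) (m+[n∸m]≡n (≰⇒≥ n≰b)) , s≤s |cs|≤B , ≤-refl ∷ cs≤b

n≤m*ceilDiv : ∀ n m → 0 < m → n ≤ m * ceilDiv n m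
n≤m*ceilDiv n (suc m) _ = +-cancelʳ-≤ m _ _ (begin
  n + m                           ≡⟨ m≡m%n+[m/n]*n (n + m) (suc m) ⟩
  (n + m) % suc m + q * suc m     ≤⟨ +-monoˡ-≤ (q * suc m) (s≤s⁻¹ (m%n<n (n + m) (suc m))) ⟩
  m + q * suc m                   ≡⟨ trans (+-comm m _) (cong (_+ m) (*-comm q (suc m))) ⟩
  suc m * q + m                   ∎)
  where
  open ≤-Reasoning
  q = (n + m) / suc m

log-bounds : ∀ n → 0 < n → ∃ λ l → n ≤ 2 ^ l × 2 ^ l ≤ 2 * n
log-bounds (suc zero)       _ = 0 , s≤s z≤n , s≤s z≤n
log-bounds (suc n@(suc n-1)) _ with log-bounds n (s≤s z≤n)
... | l , lower , upper with suc n ≤? 2 ^ l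
... | yes le = l , le , ≤-trans upper (*-monoʳ-≤ 2 (n≤1+n n))
... | no ¬le = suc l , ≤-trans (m<n+m n (s≤s z≤n)) (≤-trans (≤-reflexive (cong (n +_) (sym (+-identityʳ n)))) (*-monoʳ-≤ 2 lower))
                     , *-monoʳ-≤ 2 (≤-trans (s≤s⁻¹ (≰⇒> ¬le)) (n≤1+n n))

-- The source of the constant 106: with `l < 2 ^ l ≤ 4 * n` the leading product is at most
-- `8 * 13 * n ^ 4`, and the two additive units contribute `n ^ 4` each.
voting-size : ∀ n l → 0 < n → 2 ^ l ≤ 4 * n →
              suc (n * suc (2 ^ l * (2 * n) * suc (l * 3))) ≤ 106 * n ^ 4
voting-size n l 0<n 2^l≤ = begin
  suc (n * suc (2 ^ l * (2 * n) * suc (l * 3)))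
    ≤⟨ s≤s (*-monoʳ-≤ n (s≤s (*-mono-≤ (*-monoˡ-≤ (2 * n) 2^l≤)
         (+-mono-≤ 0<n (*-monoˡ-≤ 3 (≤-trans (<⇒≤ (n<2^n l)) 2^l≤)))))) ⟩
  1 + n * (1 + 4 * n * (2 * n) * (n + 4 * n * 3))
    ≤⟨ +-mono-≤ (1≤n^ 4) (*-monoʳ-≤ n (+-monoˡ-≤ _ (1≤n^ 3))) ⟩
  n ^ 4 + n * (n ^ 3 + 4 * n * (2 * n) * (n + 4 * n * 3))
    ≡⟨ lemma n ⟩
  106 * n ^ 4 ∎
  where
  open ≤-Reasoning
  1≤n^ : ∀ k → 1 ≤ n ^ k
  1≤n^ k = m^n>0 n {{>-nonZero 0<n}} k
  lemma : ∀ n → n * (n * (n * (n * 1))) + n * (n * (n * (n * 1)) + 4 * n * (2 * n) * (n + 4 * n * 3)) ≡ 106 * (n * (n * (n * (n * 1))))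
  lemma = solve-∀

-- The bound is met without the subexponential term: the difference it has to dominate is 0.
Bound-intro : ∀ K k n d t → t ≤ K * n * d * (2 ^ ceilDiv n (d / 8) + 1) + K * n ^ K → Bound K k n d t
Bound-intro K k n d t le p (suc q) _ lt rewrite m≤n⇒m∸n≡0 le with lt
... | ()

-- Since `n ≥ 1`, `suc n ≤ 2 * n`; regrouping `2 * 64 = 16 * 8` turns the number `m` of blocks into
-- the depth `d`. The voting part uses `n ^ 4 ≤ n ^ K`.
budget-bound : ∀ K n d m p s → 106 ≤ K → 0 < n → 8 * m ≤ d → s ≤ 106 * n ^ 4 →
               suc n * (64 * m) * p + s ≤ K * n * d * p + K * n ^ K
budget-bound K n d m p s 106≤K 0<n 8m≤d s≤ = +-mono-≤
  (*-monoˡ-≤ p (begin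
    suc n * (64 * m)        ≤⟨ *-monoˡ-≤ (64 * m) (+-monoˡ-≤ n 0<n) ⟩
    (n + n) * (64 * m)      ≡⟨ lemma n m ⟩
    16 * n * (8 * m)        ≤⟨ *-mono-≤ (*-monoˡ-≤ n (≤-trans (≤ᵇ⇒≤ 16 106 tt) 106≤K)) 8m≤d ⟩
    K * n * d               ∎))
  (≤-trans s≤ (*-mono-≤ 106≤K (^-monoʳ-≤ n {{>-nonZero 0<n}} (≤-trans (≤ᵇ⇒≤ 4 106 tt) 106≤K))))
  where
  open ≤-Reasoning
  lemma : ∀ n m → (n + n) * (64 * m) ≡ 16 * n * (8 * m)
  lemma = solve-∀

from-blocks : ∀ K k {n} cs l d → 106 ≤ K → sum cs ≡ n → 0 < n → length cs ≤ d / 8 →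
              All (_≤ ceilDiv n (d / 8)) cs → n ≤ 2 ^ l → 2 ^ l ≤ 2 * n → (M : Model n) (f : BF n) →
              Σ ℕ λ t → ρ≤ M f d t × Bound K k n d t
-- The empty list has sum 0, which `0<n` excludes.
from-blocks K k cs@(c ∷ cs′) l d 106≤K refl 0<n |cs|≤ cs≤b n≤2^l 2^l≤2n M f =
    budget , approximation , Bound-intro K k n₀ d budget
      (≤-trans (≤-reflexive (cong (λ a → suc n₀ * a * (2 ^ b + 1) + top-size) 1+a≡))
               (budget-bound K n₀ d (length cs) (2 ^ b + 1) top-size 106≤K 0<n 8*|cs|≤d
                  (voting-size n₀ (suc l) 0<n 2^l′≤4n)))
  where
  open Approximation c cs′ using (n₀; module Sized)
  b = ceilDiv n₀ (d / 8)
  8*|cs|≤d : 8 * length cs ≤ d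
  8*|cs|≤d = ≤-trans (*-monoʳ-≤ 8 |cs|≤) (≤-trans (≤-reflexive (*-comm 8 (d / 8))) (m/n*n≤m d 8))
  -- Rows have length `suc l`: the additional draw absorbs the factor 8 that `Amplification`
  -- demands.
  8n≤8^l′ : 8 * n₀ ≤ 8 ^ suc l
  8n≤8^l′ = *-monoʳ-≤ 8 (≤-trans n≤2^l (^-monoˡ-≤ l (≤ᵇ⇒≤ 2 8 tt)))
  2^l′≤4n : 2 ^ suc l ≤ 4 * n₀
  2^l′≤4n = ≤-trans (*-monoʳ-≤ 2 2^l≤2n) (≤-reflexive (sym (*-assoc 2 2 n₀)))
  1+a≡ : suc (pred (64 * length cs)) ≡ 64 * length cs
  1+a≡ = suc-pred (64 * length cs)
  open Sized M f b d (suc l) cs≤b 8*|cs|≤d 0<n 8n≤8^l′ (pred (64 * length cs)) 1+a≡ using (budget; top-size; approximation)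

depth-distance : ∀ K k → 106 ≤ K → ∀ n (M : Model n) (f : BF n) d → 8 ≤ d →
                 Σ ℕ λ t → ρ≤ M f d t × Bound K k n d t
depth-distance K k 106≤K zero M f d 8≤d =
  -- Without variables `f` is itself a constant, which the model represents exactly.
  0 , (const f , z≤n , [] , z≤n , [] , λ v differs → ⊥-elim (true≢false (trans (sym differs) (xor-same f))))
    , Bound-intro K k 0 d 0 z≤n
depth-distance K k 106≤K n@(suc _) M f d 8≤d =
  let cs , eq , |cs|≤ , cs≤b = blocks (d / 8) (ceilDiv n (d / 8)) n (n≤m*ceilDiv n (d / 8) (/-monoˡ-≤ 8 8≤d))
      l , n≤2^l , 2^l≤2n     = log-bounds n (s≤s z≤n)
  in  from-blocks K k cs l d 106≤K eq (s≤s z≤n) |cs|≤ cs≤b n≤2^l 2^l≤2n M f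

theorem4 : ∃₂ λ (K k : ℕ) →
    ∀ (n : ℕ) (M : Model n) (f : BF n) (d : ℕ) → 8 ≤ d →
    Σ ℕ λ t → ρ≤ M f d t × Bound K k n d t
theorem4 = 106 , 0 , depth-distance 106 0 ≤-refl
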